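{- Let $N\ge2$, $T\ge1$, loads $L_1,\dots,L_T\in\mathbb{R}_{\ge0}^N$ and SLAs $\beta(i)\ge0$ be given. For any $0<\varepsilon\le\frac1{10}$ and $0<\eta<\frac13$, Algorithm 2 (defined in the context) run with parameters $\varepsilon,\eta$ guarantees $$\mathrm{work}_{h_1^*,\dots,h_t^*}-\mathrm{work}_{\mathrm{alg},t}\ \le\ 8\,\frac{N}{\varepsilon^2\eta}\,\ln(N/\varepsilon)$$ for any time $1\le t\le T$, where $h_1^*,\dots,h_T^*$ is an optimal offline sequence of $(1-4\varepsilon)$-allocations (maximizing total work over the horizon $T$ among sequences of $(1-4\varepsilon)$-allocations, loads known in advance) and $\mathrm{work}_{\mathrm{alg},t}=\sum_i\sum_{\tau=1}^t w_\tau(i)$ is the overall work done by Algorithm 2 until time $t$.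
   Context: Model. There are $N\ge 2$ users sharing one resource of capacity $1$ over discrete times $t=1,\dots,T$. User $i$ has an SLA $\beta(i)\ge 0$ (here $\sum_i\beta(i)$ is allowed to exceed $1$). At time $t$ a load $L_t(i)\ge 0$ arrives for user $i$. Given allocations $h_1,\dots,h_T\in[0,1]^N$ with $\sum_i h_t(i)\le 1$, the work and the queues are defined by $Q_1(i)=0$ and $$w_t(i)=\min\{h_t(i),\,L_t(i)+Q_t(i)\},\qquad Q_{t+1}(i)=\max\{0,\,L_t(i)+Q_t(i)-h_t(i)\}.$$ The work of the allocations up to time $t$ is $\mathrm{work}_{h_1,\dots,h_t}=\sum_{s=1}^t\sum_{i=1}^N w_s(i)$. For $0<\delta<1$, a $(1-\delta)$-allocation is a vector $h\in[0,1]^N$ with $\sum_i h(i)\le1-\delta$. At time $t$ the only feedback is the set of active users $A_t=\{i: Q_t(i)>0\}$ and inactive users $B_t=\{1,\dots,N\}\setminus A_t$. Truncated simplex and projection. $\Delta_\varepsilon=\{x\in\mathbb{R}^N:\sum_i x(i)=1,\ x(i)\ge\varepsilon/N\ \forall i\}$, and for $y$ with positive entries $\pi_{\Delta_\varepsilon}(y)=\operatorname{argmin}_{x\in\Delta_\varepsilon}\sum_i x(i)\log(x(i)/y(i))$. Algorithm 2 (parameters $\varepsilon,\eta$). Set $\lambda=\frac{\varepsilon^2}{8N}$ and let $h_1$ be any element of $\Delta_\varepsilon$. For $t=1,\dots,T$: use allocation $h_t$; read $A_t,B_t$; let $A_t^1=\left\{i\in A_t:h_t(i)<(1-\varepsilon)\frac{\beta(i)}{\sum_{j\in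 A_t}\beta(j)}\right\}$ (with $A_t^1=\emptyset$ if $\sum_{j\in A_t}\beta(j)=0$) and $A_t^2=A_t\setminus A_t^1$; set $g_t(i)=1+\lambda$ for $i\in A_t^1$, $g_t(i)=1$ for $i\in A_t^2$, $g_t(i)=0$ for $i\in B_t$; set $\widehat h_{t+1}(i)=h_t(i)e^{\eta g_t(i)}$ and $h_{t+1}=\pi_{\Delta_\varepsilon}(\widehat h_{t+1})$. -}

module Defs where

open import Algebra.Apartness.Bundles using (HeytingCommutativeRing; HeytingField)
open import Algebra.Apartness.Structures using (IsHeytingField)
open import Algebra.Bundles using (CommutativeRing)
open import Algebra.Core using (Op₁; Op₂)
import Algebra.Definitions.RawMonoid as RawMonoidDefinitions
import Algebra.Properties.Ring as RingProperties
open import Data.Bool.Base using (if_then_else_)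
open import Data.Fin.Base using (Fin; toℕ)
open import Data.Fin.Subset using (Subset; _∈_)
open import Data.Fin.Subset.Properties using (_∈?_)
open import Data.Nat.Base as ℕ using (ℕ; zero; suc; z≤n; s≤s)
open import Data.Nat.Properties using (≤-trans)
open import Data.Product.Base using (Σ; ∃; _×_; _,_; proj₁; proj₂)
open import Data.Sum.Base using (_⊎_; inj₁; inj₂)
open import Data.Vec.Functional using (Vector)
open import Function.Bundles using (_⇔_)
open import Level using (Level; _⊔_) renaming (suc to lsuc)
open import Relation.Binary.Core using (Rel)
open import Relation.Binary.Definitions using (Cotransitive)
open import Relation.Binary.Lattice.Structures using (IsLattice)
open import Relation.Binary.Structures using (IsStrictPartialOrder)
open import Relation.Nullary.Decidable.Core using (does)
open import Relation.Nullary.Negation using (¬_; contradiction)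

-- The order is not assumed decidable: `x ≤ y` is `¬ (y < x)` and apartness is
-- `x < y ⊎ y < x`.

record OrderedField (c ℓ₁ ℓ₂ : Level) : Set (lsuc (c ⊔ ℓ₁ ⊔ ℓ₂)) where
  infix  8 -_
  infixl 7 _*_
  infixl 6 _+_
  infix  4 _≈_ _<_ _≤_ _#_
  field
    ℝ    : Set c
    _≈_  : Rel ℝ ℓ₁
    _<_  : Rel ℝ ℓ₂
    _+_  : Op₂ ℝ
    _*_  : Op₂ ℝ
    -_   : Op₁ ℝ
    0#   : ℝ
    1#   : ℝ
    max  : Op₂ ℝ
    min  : Op₂ ℝ

  _≤_ : Rel ℝ ℓ₂
  x ≤ y = ¬ (y < x)

  _#_ : Rel ℝ ℓ₂
  x # y = x < y ⊎ y < x

  field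
    isHeytingField       : IsHeytingField _≈_ _#_ _+_ _*_ -_ 0# 1#
    isStrictPartialOrder : IsStrictPartialOrder _≈_ _<_
    <-cotrans            : Cotransitive _<_
    isLattice            : IsLattice _≈_ _≤_ max min
    0<1                  : 0# < 1#
    +-monoˡ-<            : ∀ z {x y} → x < y → x + z < y + z
    *-pos                : ∀ {x y} → 0# < x → 0# < y → 0# < x * y

  heytingField : HeytingField c ℓ₁ ℓ₂
  heytingField = record { isHeytingField = isHeytingField }

  open HeytingField heytingField public
    using (heytingCommutativeRing)
  open HeytingCommutativeRing heytingCommutativeRing public
    using (commutativeRing; #⇒invertible; invertible⇒#)
  open CommutativeRing commutativeRing public
    hiding (Carrier; _≈_; _+_; _*_; -_; 0#; 1#)
  open IsStrictPartialOrder isStrictPartialOrder public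
    using (<-respˡ-≈; <-respʳ-≈)
    renaming (trans to <-trans; irrefl to <-irrefl)
  open RawMonoidDefinitions +-rawMonoid public
    using (sum) renaming (_×_ to _·_)

  fromℕ : ℕ → ℝ
  fromℕ n = n · 1#

  <-≤-trans : ∀ {x y z} → x < y → y ≤ z → x < z
  <-≤-trans {z = z} x<y y≤z with <-cotrans x<y z
  ... | inj₁ x<z = x<z
  ... | inj₂ z<y = contradiction z<y y≤z

  fromℕ-pos : ∀ n → 1 ℕ.≤ n → 0# < fromℕ n
  fromℕ-pos (suc zero)    _ = <-respʳ-≈ (sym (+-identityʳ 1#)) 0<1
  fromℕ-pos (suc (suc n)) _ = <-trans 0<1
    (<-respˡ-≈ (+-identityˡ 1#)
      (<-respʳ-≈ (+-comm (fromℕ (suc n)) 1#) (+-monoˡ-< 1# (fromℕ-pos (suc n) (s≤s z≤n)))))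

  x-0≈x : ∀ x → x - 0# ≈ x
  x-0≈x x = trans (+-congˡ (RingProperties.-0#≈0# ring)) (+-identityʳ x)

  infix 8 _⁻¹[_]
  _⁻¹[_] : ∀ x → 0# < x → ℝ
  x ⁻¹[ 0<x ] = proj₁ (#⇒invertible {x} {0#} (inj₂ 0<x))

  ⁻¹-inverseˡ : ∀ x (0<x : 0# < x) → x ⁻¹[ 0<x ] * x ≈ 1#
  ⁻¹-inverseˡ x 0<x = trans (*-congˡ (sym (x-0≈x x)))
    (proj₁ (proj₂ (#⇒invertible {x} {0#} (inj₂ 0<x))))

  ⁻¹-pos : ∀ x (0<x : 0# < x) → 0# < x ⁻¹[ 0<x ]
  ⁻¹-pos x 0<x = pos (invertible⇒# {i} {0#} (x , x*i≈1 , i*x≈1))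
    where
    open RingProperties ring using (-‿distribˡ-*)
    i = x ⁻¹[ 0<x ]

    i*x≈1 : (i - 0#) * x ≈ 1#
    i*x≈1 = trans (*-congʳ (x-0≈x i)) (⁻¹-inverseˡ x 0<x)

    x*i≈1 : x * (i - 0#) ≈ 1#
    x*i≈1 = trans (*-comm x (i - 0#)) i*x≈1

    pos : i # 0# → 0# < i
    pos (inj₂ 0<i) = 0<i
    pos (inj₁ i<0) = contradiction (<-trans 0<1 1<0) (<-irrefl refl)
      where
      0<-i : 0# < - i
      0<-i = <-respˡ-≈ (-‿inverseʳ i)
        (<-respʳ-≈ (+-identityˡ (- i)) (+-monoˡ-< (- i) i<0))

      0<-1 : 0# < - 1#
      0<-1 = <-respʳ-≈
        (trans (sym (-‿distribˡ-* i x)) (-‿cong (⁻¹-inverseˡ x 0<x)))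
        (*-pos 0<-i 0<x)

      1<0 : 1# < 0#
      1<0 = <-respˡ-≈ (+-identityˡ 1#)
        (<-respʳ-≈ (-‿inverseˡ 1#) (+-monoˡ-< 1# 0<-1))

  infixl 7 _÷_[_]
  _÷_[_] : ∀ x y → 0# < y → ℝ
  x ÷ y [ 0<y ] = x * y ⁻¹[ 0<y ]

  ÷-pos : ∀ {x y} → 0# < x → (0<y : 0# < y) → 0# < x ÷ y [ 0<y ]
  ÷-pos {y = y} 0<x 0<y = *-pos 0<x (⁻¹-pos y 0<y)

-- The real numbers: a Cauchy complete Archimedean ordered field, with its
-- exponential and logarithm.  Both the classical reals and Bishop's reals
-- satisfy these axioms.

record RealNumbers (c ℓ₁ ℓ₂ : Level) : Set (lsuc (c ⊔ ℓ₁ ⊔ ℓ₂)) where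
  infix 4 _ConvergesTo_
  field
    orderedField : OrderedField c ℓ₁ ℓ₂

  open OrderedField orderedField public

  Cauchy : (ℕ → ℝ) → Set (c ⊔ ℓ₂)
  Cauchy u = ∀ δ → 0# < δ →
    ∃ λ m → ∀ p q → m ℕ.≤ p → m ℕ.≤ q → u p - u q < δ

  _ConvergesTo_ : (ℕ → ℝ) → ℝ → Set (c ⊔ ℓ₂)
  u ConvergesTo l = ∀ δ → 0# < δ →
    ∃ λ m → ∀ p → m ℕ.≤ p → (u p - l < δ) × (l - u p < δ)

  field
    archimedean : ∀ x → ∃ λ n → x < fromℕ n
    complete    : ∀ u → Cauchy u → ∃ λ l → u ConvergesTo l

    -- `exp-+` and `1+x≤exp` determine `exp` uniquely: they give
    -- (1 + x/n)ⁿ ≤ exp x ≤ (1 - x/n)⁻ⁿ for all n > ∣x∣.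
    exp      : ℝ → ℝ
    exp-cong : ∀ {x y} → x ≈ y → exp x ≈ exp y
    exp-+    : ∀ x y → exp (x + y) ≈ exp x * exp y
    exp-pos  : ∀ x → 0# < exp x
    1+x≤exp  : ∀ x → 1# + x ≤ exp x

    ln     : ∀ x → 0# < x → ℝ
    exp-ln : ∀ x (0<x : 0# < x) → exp (ln x 0<x) ≈ x

-- Sequences indexed by time are functions on ℕ whose value at s belongs to
-- time s + 1; values at indices s ≥ T beyond the horizon never matter.

module Model {c ℓ₁ ℓ₂} (R : RealNumbers c ℓ₁ ℓ₂) (N : ℕ) (2≤N : 2 ℕ.≤ N) where
  open RealNumbers R

  0<N : 0# < fromℕ N
  0<N = fromℕ-pos N (≤-trans (s≤s z≤n) 2≤N)

  Profile : Set c
  Profile = ℕ → Vector ℝ N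

  queue : (L h : Profile) → Profile
  queue L h zero    i = 0#
  queue L h (suc s) i = max 0# (L s i + queue L h s i - h s i)

  workAt : (L h : Profile) → Profile
  workAt L h s i = min (h s i) (L s i + queue L h s i)

  work : (L h : Profile) → ℕ → ℝ
  work L h t = sum {t} λ s → sum λ i → workAt L h (toℕ s) i

  record IsAllocation (δ : ℝ) (h : Vector ℝ N) : Set ℓ₂ where
    field
      0≤h     : ∀ i → 0# ≤ h i
      h≤1     : ∀ i → h i ≤ 1#
      sum≤1-δ : sum h ≤ 1# - δ

  record IsOptimal (δ : ℝ) (L : Profile) (T : ℕ) (h : Profile) : Set (c ⊔ ℓ₂) where
    field
      isAllocation : ∀ s → s ℕ.< T → IsAllocation δ (h s)
      maximal      : ∀ h′ → (∀ s → s ℕ.< T → IsAllocation δ (h′ s)) →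
                     work L h′ T ≤ work L h T

  record Δ (ε : ℝ) : Set (c ⊔ ℓ₁ ⊔ ℓ₂) where
    field
      coord : Vector ℝ N
      sum≈1 : sum coord ≈ 1#
      ε/N≤  : ∀ i → ε ÷ fromℕ N [ 0<N ] ≤ coord i

  open Δ public using (coord)

  Δ-pos : ∀ {ε} → 0# < ε → (x : Δ ε) → ∀ i → 0# < coord x i
  Δ-pos 0<ε x i = <-≤-trans (÷-pos 0<ε 0<N) (Δ.ε/N≤ x i)

  divergence : (x y : Vector ℝ N) → (∀ i → 0# < x i) → (∀ i → 0# < y i) → ℝ
  divergence x y 0<x 0<y = sum λ i →
    x i * ln (x i ÷ y i [ 0<y i ]) (÷-pos (0<x i) (0<y i))

  IsProjection : ∀ {ε} → 0# < ε →
                 (y : Vector ℝ N) → (∀ i → 0# < y i) → Δ ε → Set (c ⊔ ℓ₁ ⊔ ℓ₂)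
  IsProjection {ε} 0<ε y 0<y x = ∀ (z : Δ ε) →
    divergence (coord x) y (Δ-pos 0<ε x) 0<y ≤
    divergence (coord z) y (Δ-pos 0<ε z) 0<y

  sumOver : Subset N → Vector ℝ N → ℝ
  sumOver A β = sum λ j → if does (j ∈? A) then β j else 0#

  -- False when the SLAs of the active users sum to 0, so that A¹ is then empty.
  Underserved : (ε : ℝ) (β : Vector ℝ N) (A : Subset N) (h : Vector ℝ N) →
                Fin N → Set ℓ₂
  Underserved ε β A h i = Σ (0# < sumOver A β) λ 0<β[A] →
    h i < (1# - ε) * (β i ÷ sumOver A β [ 0<β[A] ])

  boost : ℝ → ℝ
  boost ε = (ε * ε) ÷ (fromℕ 8 * fromℕ N) [ *-pos (fromℕ-pos 8 (s≤s z≤n)) 0<N ]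

  gain : (ε : ℝ) (A A¹ : Subset N) → Vector ℝ N
  gain ε A A¹ i =
    if does (i ∈? A¹) then 1# + boost ε else
    if does (i ∈? A)  then 1#           else 0#

  -- An execution of the algorithm.  The sets A and A¹ are recorded as data
  -- because the order on ℝ is not assumed decidable; both are determined by
  -- the allocations through the two equivalences.
  record Algorithm2 (L : Profile) (β : Vector ℝ N) (T : ℕ)
                    (ε : ℝ) (0<ε : 0# < ε) (η : ℝ) : Set (c ⊔ ℓ₁ ⊔ ℓ₂) where
    field
      point : ℕ → Δ ε
      A A¹  : ℕ → Subset N

    h : Profile
    h s = coord (point s)

    ĥ : Profile
    ĥ s i = h s i * exp (η * gain ε (A s) (A¹ s) i)

    ĥ-pos : ∀ s i → 0# < ĥ s i
    ĥ-pos s i = *-pos (Δ-pos 0<ε (point s) i) (exp-pos _)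

    field
      active      : ∀ s → s ℕ.< T → ∀ i → i ∈ A s ⇔ 0# < queue L h s i
      underserved : ∀ s → s ℕ.< T → ∀ i →
                    i ∈ A¹ s ⇔ (i ∈ A s × Underserved ε β (A s) (h s) i)
      step        : ∀ s → s ℕ.< T → IsProjection 0<ε (ĥ s) (ĥ-pos s) (point (suc s))

{-# OPTIONS --safe #-}

-- Work gap and total backlog gap are the same quantity, so it suffices to bound
-- S t = Σᵢ (Q t i − Q* t i) by N c with c = 8 ln (N/ε) / (ε² η).  If S t exceeds
-- N c, then Q t i − Q* t i > c for some user i.  This difference drops by at most
-- 1 per step backwards in time, so i has been active during the last ~ c steps.
-- On such a period the regret bound of multiplicative weights against (almost)
-- the i-th vertex of the simplex shows that the algorithm leaves only a fraction
-- < 4ε of the capacity to inactive users, up to a total of O(ln (N/ε) / η).  The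
-- feedback is one step late, which costs a constant factor because an update
-- shrinks no coordinate by more than exp (−η (1 + λ)).  Since the comparator
-- gives up 4ε per step, S t is at most an earlier value of S, which is bounded by
-- induction.  Goals of the form x ≤ y are negations, which makes the argument by
-- contradiction constructive.
module Submission where

open import Defs
import Algebra.Properties.Ring as RingProperties
import Algebra.Properties.Semiring.Mult as Mult
import Algebra.Properties.Semiring.Sum as Sum
import Algebra.Solver.Ring as RingSolver
open import Algebra.Solver.Ring.AlmostCommutativeRing
  using (_-Raw-AlmostCommutative⟶_; fromCommutativeRing)
open import Data.Bool.Base using (true; false; if_then_else_)
open import Data.Fin.Base using (Fin; zero; suc; toℕ)
open import Data.Fin.Properties using (_≟_)
open import Data.Fin.Subset using (Subset; _∈_; _∉_)
open import Data.Fin.Subset.Properties using (_∈?_)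
open import Data.Integer.Base as ℤ using (ℤ; +_; -[1+_])
import Data.Integer.Properties as ℤ
open import Data.Maybe.Base using (Maybe; just; nothing)
open import Data.Nat.Base as ℕ using (ℕ; zero; suc; s≤s; z≤n)
import Data.Nat.Properties as ℕ
open import Data.Product.Base using (_×_; _,_; proj₁)
open import Data.Sum.Base using (inj₁; inj₂; [_,_]′)
open import Data.Vec.Functional using (Vector)
open import Function.Base using (_∘_)
open import Function.Bundles using (Equivalence)
open import Relation.Binary.Lattice.Structures using (IsLattice)
import Relation.Binary.PropositionalEquality.Core as ≡
open import Relation.Nullary.Decidable.Core using (Dec; yes; no; does)
open import Relation.Nullary.Negation using (¬_; contradiction)

-- Ordered fields: a ring solver with integer coefficients, order arithmetic and finite sums.

module OrderedFieldProperties {c ℓ₁ ℓ₂} (F : OrderedField c ℓ₁ ℓ₂) where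
  open OrderedField F hiding (zero)
  open RingProperties ring
    using (-0#≈0#; -‿involutive; -‿distribˡ-*; -‿distribʳ-*; -‿+-comm)
  open Mult semiring using (×-homo-+; ×1-homo-*)
  open import Relation.Binary.Reasoning.Setoid setoid

  -- The values at 0 and 1 are chosen so that the constants of the solver
  -- evaluate definitionally to 0#, 1# and fromℕ n.
  fromℤ : ℤ → ℝ
  fromℤ (+ 1)    = 1#
  fromℤ (+ n)    = fromℕ n
  fromℤ -[1+ n ] = - fromℕ (suc n)

  private
    fromℤ-+ : ∀ n → fromℤ (+ n) ≈ fromℕ n
    fromℤ-+ 0             = refl
    fromℤ-+ 1             = sym (+-identityʳ 1#)
    fromℤ-+ (suc (suc n)) = refl

    fromℤ-neg : ∀ i → fromℤ (ℤ.- i) ≈ - fromℤ i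
    fromℤ-neg (+ 0)             = sym -0#≈0#
    fromℤ-neg (+ 1)             = -‿cong (+-identityʳ 1#)
    fromℤ-neg (+ suc (suc n))   = refl
    fromℤ-neg -[1+ n ]          = trans (fromℤ-+ (suc n)) (sym (-‿involutive _))

    fromℤ-⊖ : ∀ m n → fromℤ (m ℤ.⊖ n) ≈ fromℕ m - fromℕ n
    fromℤ-⊖ m zero = trans (fromℤ-+ m) (sym (x-0≈x _))
    fromℤ-⊖ zero (suc n) = sym (+-identityˡ _)
    fromℤ-⊖ (suc m) (suc n) = begin
      fromℤ (suc m ℤ.⊖ suc n)          ≡⟨ ≡.cong fromℤ (ℤ.[1+m]⊖[1+n]≡m⊖n m n) ⟩
      fromℤ (m ℤ.⊖ n)                  ≈⟨ fromℤ-⊖ m n ⟩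
      fromℕ m - fromℕ n                ≈⟨ +-congˡ (+-identityˡ _) ⟨
      fromℕ m + (0# - fromℕ n)         ≈⟨ +-congˡ (+-congʳ (-‿inverseʳ 1#)) ⟨
      fromℕ m + (1# - 1# - fromℕ n)    ≈⟨ +-congˡ (+-assoc _ _ _) ⟩
      fromℕ m + (1# + (- 1# - fromℕ n)) ≈⟨ +-assoc _ _ _ ⟨
      fromℕ m + 1# + (- 1# - fromℕ n)  ≈⟨ +-cong (+-comm _ _) (-‿+-comm _ _) ⟩
      1# + fromℕ m - (1# + fromℕ n)    ∎

    fromℤ-homo-+ : ∀ i j → fromℤ (i ℤ.+ j) ≈ fromℤ i + fromℤ j
    fromℤ-homo-+ (+ m) (+ n) = begin
      fromℤ (+ (m ℕ.+ n))          ≈⟨ fromℤ-+ (m ℕ.+ n) ⟩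
      fromℕ (m ℕ.+ n)              ≈⟨ ×-homo-+ 1# m n ⟩
      fromℕ m + fromℕ n            ≈⟨ +-cong (fromℤ-+ m) (fromℤ-+ n) ⟨
      fromℤ (+ m) + fromℤ (+ n)    ∎
    fromℤ-homo-+ (+ m) -[1+ n ] = trans (fromℤ-⊖ m (suc n)) (+-congʳ (sym (fromℤ-+ m)))
    fromℤ-homo-+ -[1+ m ] (+ n) =
      trans (fromℤ-⊖ n (suc m)) (trans (+-comm _ _) (+-congˡ (sym (fromℤ-+ n))))
    fromℤ-homo-+ -[1+ m ] -[1+ n ] = begin
      - fromℕ (suc (suc (m ℕ.+ n)))     ≡⟨ ≡.cong (λ k → - fromℕ (suc k)) (ℕ.+-suc m n) ⟨
      - fromℕ (suc m ℕ.+ suc n)         ≈⟨ -‿cong (×-homo-+ 1# (suc m) (suc n)) ⟩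
      - (fromℕ (suc m) + fromℕ (suc n)) ≈⟨ -‿+-comm _ _ ⟨
      - fromℕ (suc m) - fromℕ (suc n)   ∎

    fromℤ-homo-+* : ∀ m j → fromℤ (+ m ℤ.* j) ≈ fromℕ m * fromℤ j
    fromℤ-homo-+* m (+ n) = begin
      fromℤ (+ m ℤ.* + n)     ≡⟨ ≡.cong fromℤ (ℤ.pos-* m n) ⟨
      fromℤ (+ (m ℕ.* n))     ≈⟨ fromℤ-+ (m ℕ.* n) ⟩
      fromℕ (m ℕ.* n)         ≈⟨ ×1-homo-* m n ⟩
      fromℕ m * fromℕ n       ≈⟨ *-congˡ (fromℤ-+ n) ⟨
      fromℕ m * fromℤ (+ n)   ∎
    fromℤ-homo-+* m -[1+ n ] = begin
      fromℤ (+ m ℤ.* -[1+ n ])            ≡⟨ ≡.cong fromℤ (ℤ.neg-distribʳ-* (+ m) (+ suc n)) ⟨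
      fromℤ (ℤ.- (+ m ℤ.* + suc n))       ≈⟨ fromℤ-neg (+ m ℤ.* + suc n) ⟩
      - fromℤ (+ m ℤ.* + suc n)           ≈⟨ -‿cong (fromℤ-homo-+* m (+ suc n)) ⟩
      - (fromℕ m * fromℤ (+ suc n))       ≈⟨ -‿cong (*-congˡ (fromℤ-+ (suc n))) ⟩
      - (fromℕ m * fromℕ (suc n))         ≈⟨ -‿distribʳ-* _ _ ⟩
      fromℕ m * - fromℕ (suc n)           ∎

    fromℤ-homo-* : ∀ i j → fromℤ (i ℤ.* j) ≈ fromℤ i * fromℤ j
    fromℤ-homo-* (+ m) j = trans (fromℤ-homo-+* m j) (*-congʳ (sym (fromℤ-+ m)))
    fromℤ-homo-* -[1+ m ] j = begin
      fromℤ (-[1+ m ] ℤ.* j)         ≡⟨ ≡.cong fromℤ (ℤ.neg-distribˡ-* (+ suc m) j) ⟨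
      fromℤ (ℤ.- (+ suc m ℤ.* j))    ≈⟨ fromℤ-neg (+ suc m ℤ.* j) ⟩
      - fromℤ (+ suc m ℤ.* j)        ≈⟨ -‿cong (fromℤ-homo-+* (suc m) j) ⟩
      - (fromℕ (suc m) * fromℤ j)    ≈⟨ -‿distribˡ-* _ _ ⟩
      - fromℕ (suc m) * fromℤ j      ∎

    ℤ⟶ℝ : ℤ.+-*-rawRing -Raw-AlmostCommutative⟶ fromCommutativeRing commutativeRing
    ℤ⟶ℝ = record
      { ⟦_⟧ = fromℤ ; +-homo = fromℤ-homo-+ ; *-homo = fromℤ-homo-*
      ; -‿homo = fromℤ-neg ; 0-homo = refl ; 1-homo = refl }

    _coeff≟_ : ∀ i j → Maybe (fromℤ i ≈ fromℤ j)
    i coeff≟ j with i ℤ.≟ j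
    ... | yes i≡j = just (reflexive (≡.cong fromℤ i≡j))
    ... | no  _   = nothing

  open RingSolver ℤ.+-*-rawRing (fromCommutativeRing commutativeRing) ℤ⟶ℝ _coeff≟_ public
    using (solve; _:=_; _:+_; _:*_; _:-_; :-_; con)

  open IsLattice isLattice public
    using (antisym; ≤-respˡ-≈; ≤-respʳ-≈)
    renaming ( refl to ≤-refl; trans to ≤-trans; reflexive to ≤-reflexive
             ; x≤x∨y to x≤max; y≤x∨y to y≤max; ∨-least to max-least
             ; x∧y≤x to min≤x; x∧y≤y to min≤y; ∧-greatest to min-greatest)

  -- The workhorse for inequalities: the difference of the two sides is written as an expression
  -- that is visibly nonnegative, and the ring solver checks the identity.
  ≤-by : ∀ {x y d} → 0# ≤ d → y - x ≈ d → x ≤ y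
  ≤-by {x} {y} {d} 0≤d y-x≈d y<x = 0≤d (<-respˡ-≈ y-x≈d
    (<-respʳ-≈ (-‿inverseʳ x) (+-monoˡ-< (- x) y<x)))

  <-by : ∀ {x y d} → 0# < d → y - x ≈ d → x < y
  <-by {x} {y} {d} 0<d y-x≈d = <-respˡ-≈ (+-identityˡ x)
    (<-respʳ-≈ (trans (+-congʳ (sym y-x≈d)) (solve 2 (λ x y → y :- x :+ x := y) refl x y))
      (+-monoˡ-< x 0<d))

  x≤y⇒0≤y-x : ∀ {x y} → x ≤ y → 0# ≤ y - x
  x≤y⇒0≤y-x {x} {y} x≤y y-x<0 = x≤y (<-respˡ-≈ (solve 2 (λ x y → y :- x :+ x := y) refl x y)
    (<-respʳ-≈ (+-identityˡ x) (+-monoˡ-< x y-x<0)))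

  x<y⇒0<y-x : ∀ {x y} → x < y → 0# < y - x
  x<y⇒0<y-x {x} {y} x<y = <-respˡ-≈ (-‿inverseʳ x) (+-monoˡ-< (- x) x<y)

  <⇒≤ : ∀ {x y} → x < y → x ≤ y
  <⇒≤ x<y y<x = <-irrefl refl (<-trans x<y y<x)

  ≤-<-trans : ∀ {x y z} → x ≤ y → y < z → x < z
  ≤-<-trans {x} x≤y y<z with <-cotrans y<z x
  ... | inj₁ y<x = contradiction y<x x≤y
  ... | inj₂ x<z = x<z

  +-nonneg : ∀ {x y} → 0# ≤ x → 0# ≤ y → 0# ≤ x + y
  +-nonneg {x} {y} 0≤x 0≤y x+y<0 with <-cotrans x+y<0 y
  ... | inj₂ y<0 = 0≤y y<0
  ... | inj₁ x+y<y = 0≤x (<-by (x<y⇒0<y-x x+y<y)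
    (solve 2 (λ x y → con (+ 0) :- x := y :- (x :+ y)) refl x y))

  +-pos-nonneg : ∀ {x y} → 0# < x → 0# ≤ y → 0# < x + y
  +-pos-nonneg {x} {y} 0<x 0≤y = ≤-<-trans 0≤y
    (<-by 0<x (solve 2 (λ x y → x :+ y :- y := x) refl x y))

  -- The conclusion is a negation, so the signs of `x` and `y` may be treated as decided: a factor
  -- that is not positive equals `0#` by antisymmetry, and then the product vanishes.
  *-nonneg : ∀ {x y} → 0# ≤ x → 0# ≤ y → 0# ≤ x * y
  *-nonneg {x} {y} 0≤x 0≤y xy<0 = 0≮x λ 0<x → 0≮y λ 0<y → <⇒≤ (*-pos 0<x 0<y) xy<0
    where
    0≮x : ¬ ¬ 0# < x
    0≮x x≤0 = <-irrefl (trans (*-congʳ (antisym x≤0 0≤x)) (zeroˡ y)) xy<0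
    0≮y : ¬ ¬ 0# < y
    0≮y y≤0 = <-irrefl (trans (*-congˡ (antisym y≤0 0≤y)) (zeroʳ x)) xy<0

  *-cancelˡ-nonneg : ∀ {x y} → 0# < x → 0# ≤ x * y → 0# ≤ y
  *-cancelˡ-nonneg {x} {y} 0<x 0≤xy y<0 = 0≤xy
    (<-by (*-pos 0<x (x<y⇒0<y-x y<0)) (solve 2 (λ x y → con (+ 0) :- x :* y := x :* (con (+ 0) :- y)) refl x y))

  *-cancelˡ-≤ : ∀ {x y z} → 0# < x → x * y ≤ x * z → y ≤ z
  *-cancelˡ-≤ {x} {y} {z} 0<x xy≤xz = ≤-by (*-cancelˡ-nonneg 0<x (≤-respʳ-≈
    (solve 3 (λ x y z → x :* z :- x :* y := x :* (z :- y)) refl x y z) (x≤y⇒0≤y-x xy≤xz))) refl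

  *-cancelˡ-pos : ∀ {x y} → 0# < x → 0# < x * y → 0# < y
  *-cancelˡ-pos {x} {y} 0<x 0<xy = <-respʳ-≈
    (trans (sym (*-assoc _ x y)) (trans (*-congʳ (⁻¹-inverseˡ x 0<x)) (*-identityˡ y)))
    (*-pos (⁻¹-pos x 0<x) 0<xy)

  *-monoˡ-≤ : ∀ {x y z} → 0# ≤ x → y ≤ z → x * y ≤ x * z
  *-monoˡ-≤ {x} {y} {z} 0≤x y≤z = ≤-by (*-nonneg 0≤x (x≤y⇒0≤y-x y≤z))
    (solve 3 (λ x y z → x :* z :- x :* y := x :* (z :- y)) refl x y z)

  square-nonneg : ∀ x → 0# ≤ x * x
  square-nonneg x x²<0 = 0≰x λ 0≤x → *-nonneg 0≤x 0≤x x²<0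
    where
    0≰x : ¬ ¬ 0# ≤ x
    0≰x ¬0≤x = ¬0≤x λ x<0 → <-irrefl refl (<-trans x²<0
      (<-respʳ-≈ (solve 1 (λ x → (con (+ 0) :- x) :* (con (+ 0) :- x) := x :* x) refl x)
        (*-pos (x<y⇒0<y-x x<0) (x<y⇒0<y-x x<0))))

  fromℕ-nonneg : ∀ n → 0# ≤ fromℕ n
  fromℕ-nonneg zero    = ≤-refl
  fromℕ-nonneg (suc n) = <⇒≤ (fromℕ-pos (suc n) (s≤s z≤n))

  -- If `x` were smaller than the maximum, `x` could not be positive, and then the maximum would not
  -- be positive either.
  0<max⇒max≤ : ∀ {x} → 0# < max 0# x → max 0# x ≤ x
  0<max⇒max≤ {x} 0<max x<max = max-least ≤-refl (λ 0<x → max-least (<⇒≤ 0<x) ≤-refl x<max) 0<max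

  -- Gives the conservation of load in `queue-suc`: what is not worked off stays in the queue.
  max≈x-min : ∀ x y → max 0# (x - y) ≈ x - min y x
  max≈x-min x y = antisym
    (max-least
      (x≤y⇒0≤y-x (min≤y y x))
      (≤-by (x≤y⇒0≤y-x (min≤x y x)) (solve 3 (λ x y m → x :- m :- (x :- y) := y :- m) refl x y (min y x))))
    (≤-by (x≤y⇒0≤y-x x-max≤min) (solve 3 (λ x n m → m :- (x :- n) := n :- (x :- m)) refl x (min y x) _))
    where
    x-max≤min : x - max 0# (x - y) ≤ min y x
    x-max≤min = min-greatest
      (≤-by (x≤y⇒0≤y-x (y≤max 0# (x - y))) (solve 3 (λ x y m → y :- (x :- m) := m :- (x :- y)) refl x y _))
      (≤-by (x≤max 0# (x - y)) (solve 2 (λ x m → x :- (x :- m) := m) refl x _))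

  open Sum semiring public
    using (sum-cong-≋; ∑-distrib-+; *-distribˡ-sum; *-distribʳ-sum)

  sum-nonneg : ∀ {n} {f : Vector ℝ n} → (∀ i → 0# ≤ f i) → 0# ≤ sum f
  sum-nonneg {zero}  0≤f = ≤-refl
  sum-nonneg {suc n} 0≤f = +-nonneg (0≤f zero) (sum-nonneg (0≤f ∘ suc))

  ∑-distrib-- : ∀ {n} (f g : Vector ℝ n) → sum (λ i → f i - g i) ≈ sum f - sum g
  ∑-distrib-- {zero}  f g = sym (-‿inverseʳ 0#)
  ∑-distrib-- {suc n} f g = trans (+-congˡ (∑-distrib-- (f ∘ suc) (g ∘ suc)))
    (solve 4 (λ a b x y → a :- b :+ (x :- y) := (a :+ x) :- (b :+ y)) refl (f zero) (g zero) _ _)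

  sum-mono-≤ : ∀ {n} {f g : Vector ℝ n} → (∀ i → f i ≤ g i) → sum f ≤ sum g
  sum-mono-≤ {f = f} {g} f≤g = ≤-by (sum-nonneg λ i → x≤y⇒0≤y-x (f≤g i)) (sym (∑-distrib-- g f))

  sum-const : ∀ n x → sum {n} (λ _ → x) ≈ fromℕ n * x
  sum-const zero    x = sym (zeroˡ x)
  sum-const (suc n) x = trans (+-congˡ (sum-const n x))
    (solve 2 (λ m x → x :+ m :* x := (con (+ 1) :+ m) :* x) refl (fromℕ n) x)

  term≤sum : ∀ {n} {f : Vector ℝ n} → (∀ i → 0# ≤ f i) → ∀ i → f i ≤ sum f
  term≤sum {f = f} 0≤f zero    = ≤-by (sum-nonneg (0≤f ∘ suc))
    (solve 2 (λ a b → a :+ b :- a := b) refl (f zero) _)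
  term≤sum {f = f} 0≤f (suc i) = ≤-trans (term≤sum (0≤f ∘ suc) i)
    (≤-by (0≤f zero) (solve 2 (λ a b → a :+ b :- b := a) refl (f zero) _))

  δ : ∀ {n} → Fin n → Vector ℝ n
  δ i j = if does (i ≟ j) then 1# else 0#

  0≤δ : ∀ {n} (i j : Fin n) → 0# ≤ δ i j
  0≤δ i j with does (i ≟ j)
  ... | true  = <⇒≤ 0<1
  ... | false = ≤-refl

  sum-δ : ∀ {n} (i : Fin n) (f : Vector ℝ n) → sum (λ j → δ i j * f j) ≈ f i
  sum-δ {suc n} zero f = begin
    1# * f zero + sum (λ j → 0# * f (suc j))    ≈⟨ +-congˡ (*-distribˡ-sum {n} 0# (f ∘ suc)) ⟨
    1# * f zero + 0# * sum (f ∘ suc)            ≈⟨ solve 2 (λ a s → con (+ 1) :* a :+ con (+ 0) :* s := a) refl _ _ ⟩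
    f zero                                      ∎
  sum-δ {suc n} (suc i) f = begin
    0# * f zero + sum (λ j → δ i j * f (suc j)) ≈⟨ +-cong (zeroˡ _) (sum-δ i (f ∘ suc)) ⟩
    0# + f (suc i)                              ≈⟨ +-identityˡ _ ⟩
    f (suc i)                                   ∎

-- The exponential and its order properties.

module RealNumbersProperties {c ℓ₁ ℓ₂} (R : RealNumbers c ℓ₁ ℓ₂) where
  open RealNumbers R hiding (zero)
  open OrderedFieldProperties orderedField public
  open import Relation.Binary.Reasoning.Setoid setoid

  ÷-* : ∀ x y (0<y : 0# < y) → x ÷ y [ 0<y ] * y ≈ x
  ÷-* x y 0<y = trans (*-assoc x _ y) (trans (*-congˡ (⁻¹-inverseˡ y 0<y)) (*-identityʳ x))

  ≤÷⇒*≤ : ∀ {x y z} (0<z : 0# < z) → x ≤ y ÷ z [ 0<z ] → z * x ≤ y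
  ≤÷⇒*≤ {x} {y} {z} 0<z x≤y/z = ≤-respʳ-≈ (trans (*-comm z _) (÷-* y z 0<z)) (*-monoˡ-≤ (<⇒≤ 0<z) x≤y/z)

  exp-0 : exp 0# ≈ 1#
  exp-0 = begin
    exp 0#                              ≈⟨ *-identityˡ _ ⟨
    1# * exp 0#                         ≈⟨ *-congʳ (⁻¹-inverseˡ _ (exp-pos 0#)) ⟨
    e⁻¹ * exp 0# * exp 0#               ≈⟨ *-assoc _ _ _ ⟩
    e⁻¹ * (exp 0# * exp 0#)             ≈⟨ *-congˡ (exp-+ 0# 0#) ⟨
    e⁻¹ * exp (0# + 0#)                 ≈⟨ *-congˡ (exp-cong (+-identityˡ 0#)) ⟩
    e⁻¹ * exp 0#                        ≈⟨ ⁻¹-inverseˡ _ (exp-pos 0#) ⟩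
    1#                                  ∎
    where e⁻¹ = exp 0# ⁻¹[ exp-pos 0# ]

  exp-- : ∀ x y → exp (x - y) * exp y ≈ exp x
  exp-- x y = trans (sym (exp-+ _ _)) (exp-cong (solve 2 (λ x y → x :- y :+ y := x) refl x y))

  exp-inverse : ∀ x → exp (- x) * exp x ≈ 1#
  exp-inverse x = trans (sym (exp-+ _ _)) (trans (exp-cong (-‿inverseˡ x)) exp-0)

  -- The difference is `exp x * (exp (y - x) - 1#)`, and by the tangent bound `1+x≤exp` the second
  -- factor is at least `y - x`.
  exp-mono-≤ : ∀ {x y} → x ≤ y → exp x ≤ exp y
  exp-mono-≤ {x} {y} x≤y = ≤-by
    (*-nonneg (<⇒≤ (exp-pos x)) (+-nonneg (x≤y⇒0≤y-x (1+x≤exp (y - x))) (x≤y⇒0≤y-x x≤y)))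
    (trans (+-congʳ (sym (exp-- y x)))
      (solve 4 (λ a b d e → e :* a :- a := a :* ((e :- (con (+ 1) :+ (d :- b))) :+ (d :- b))) refl
        (exp x) x y (exp (y - x))))

  exp-cancel-≤ : ∀ {x y} → exp x ≤ exp y → x ≤ y
  exp-cancel-≤ {x} {y} ex≤ey y<x = ex≤ey (<-by
    (*-pos (exp-pos y) (+-pos-nonneg (x<y⇒0<y-x y<x) (x≤y⇒0≤y-x (1+x≤exp (x - y)))))
    (trans (+-congʳ (sym (exp-- x y)))
      (solve 4 (λ a b d e → e :* a :- a := a :* ((d :- b) :+ (e :- (con (+ 1) :+ (d :- b))))) refl
        (exp y) y x (exp (x - y)))))

  exp-injective : ∀ {x y} → exp x ≈ exp y → x ≈ y
  exp-injective ex≈ey = antisym (exp-cancel-≤ (≤-reflexive ex≈ey))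
    (exp-cancel-≤ (≤-reflexive (sym ex≈ey)))

  exp-ln-÷ : ∀ {x y} (0<x : 0# < x) (0<y : 0# < y) →
             exp (ln (x ÷ y [ 0<y ]) (÷-pos 0<x 0<y)) * y ≈ x
  exp-ln-÷ {x} {y} 0<x 0<y = trans (*-congʳ (exp-ln _ _)) (÷-* x y 0<y)

-- Polynomial inequalities behind the constants of the bound.

module ArithmeticBounds {c ℓ₁ ℓ₂} (F : OrderedField c ℓ₁ ℓ₂) where
  open OrderedField F
  open OrderedFieldProperties F

  -- D: growth of the backlog gap; W, W′: idle allocation at two consecutive
  -- times; X: growth of the potential; n = η, e = ε, b = λ.
  drift-bound : ∀ {D W W′ X n e b p} → 0# ≤ n → 0# ≤ W → 0# ≤ W′ →
    D ≤ W - fromℕ 4 * e → p * W ≤ W′ → fromℕ 3 ≤ fromℕ 5 * p → fromℕ 3 * n ≤ fromℕ 5 * (1# - p) →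
    (1# - p) * W′ ≤ X + n * (e + b) → fromℕ 10 * b ≤ e →
    fromℕ 18 * n * D ≤ fromℕ 50 * X - fromℕ 17 * (n * e)
  drift-bound {D} {W} {W′} {X} {n} {e} {b} {p} 0≤n 0≤W 0≤W′ D≤ pW≤W′ 3≤5p 3n≤ [1-p]W′≤ 10b≤e = ≤-by
        (+-nonneg (*-nonneg (*-nonneg (fromℕ-nonneg 18) 0≤n) (x≤y⇒0≤y-x D≤))
        (+-nonneg (*-nonneg (*-nonneg (fromℕ-nonneg 6) 0≤n)
                    (+-nonneg (*-nonneg (fromℕ-nonneg 5) (x≤y⇒0≤y-x pW≤W′))
                              (*-nonneg (x≤y⇒0≤y-x 3≤5p) 0≤W)))
        (+-nonneg (*-nonneg (*-nonneg (fromℕ-nonneg 10) (x≤y⇒0≤y-x 3n≤)) 0≤W′)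
        (+-nonneg (*-nonneg (fromℕ-nonneg 50) (x≤y⇒0≤y-x [1-p]W′≤))
                  (*-nonneg (*-nonneg (fromℕ-nonneg 5) 0≤n) (x≤y⇒0≤y-x 10b≤e))))))
        (solve 8 (λ D W W′ X n e b p →
            con (+ 50) :* X :- con (+ 17) :* (n :* e) :- con (+ 18) :* n :* D
            := con (+ 18) :* n :* (W :- con (+ 4) :* e :- D)
            :+ (con (+ 6) :* n :* (con (+ 5) :* (W′ :- p :* W) :+ (con (+ 5) :* p :- con (+ 3)) :* W)
            :+ (con (+ 10) :* (con (+ 5) :* (con (+ 1) :- p) :- con (+ 3) :* n) :* W′
            :+ (con (+ 50) :* (X :+ n :* (e :+ b) :- (con (+ 1) :- p) :* W′)
            :+ con (+ 5) :* n :* (e :- con (+ 10) :* b))))) refl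
          D W W′ X n e b p)

  -- The potential contributes at most 50 `l`, the accumulated slack `κ` takes away at least 17 · 4
  -- `l` = 68 `l`, and the remaining -18 `l` pays for the last step, where the backlog gap may grow
  -- by 1, because `n ≤ l`.
  stopping-bound : ∀ {n C S″ S′ S X κ l} → 0# ≤ n → n ≤ l → S″ ≤ S′ + 1# → S ≤ C → X ≤ l →
    fromℕ 18 * n * (S′ - S) ≤ fromℕ 50 * X - fromℕ 17 * κ → fromℕ 4 * l ≤ κ →
    fromℕ 18 * n * S″ ≤ fromℕ 18 * n * C
  stopping-bound {n} {C} {S″} {S′} {S} {X} {κ} {l} 0≤n n≤l S″≤ S≤C X≤l 18nS≤ 4l≤κ = ≤-by
    (+-nonneg (*-nonneg (*-nonneg (fromℕ-nonneg 18) 0≤n) (+-nonneg (x≤y⇒0≤y-x S″≤) (x≤y⇒0≤y-x S≤C)))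
    (+-nonneg (x≤y⇒0≤y-x 18nS≤)
    (+-nonneg (*-nonneg (fromℕ-nonneg 50) (x≤y⇒0≤y-x X≤l))
    (+-nonneg (*-nonneg (fromℕ-nonneg 17) (x≤y⇒0≤y-x 4l≤κ))
              (*-nonneg (fromℕ-nonneg 18) (x≤y⇒0≤y-x n≤l))))))
    (solve 8 (λ n C S″ S′ S X κ l →
        con (+ 18) :* n :* C :- con (+ 18) :* n :* S″
        := con (+ 18) :* n :* ((S′ :+ con (+ 1) :- S″) :+ (C :- S))
        :+ ((con (+ 50) :* X :- con (+ 17) :* κ :- con (+ 18) :* n :* (S′ :- S))
        :+ (con (+ 50) :* (l :- X)
        :+ (con (+ 17) :* (κ :- con (+ 4) :* l)
        :+ con (+ 18) :* (l :- n))))) refl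
      n C S″ S′ S X κ l)

  drift-trans : ∀ {n e k S S′ S″ P P′ P″} →
    fromℕ 18 * n * (S″ - S′) ≤ fromℕ 50 * (P″ - P′) - fromℕ 17 * (n * e * k) →
    fromℕ 18 * n * (S′ - S) ≤ fromℕ 50 * (P′ - P) - fromℕ 17 * (n * e) →
    fromℕ 18 * n * (S″ - S) ≤ fromℕ 50 * (P″ - P) - fromℕ 17 * (n * e * (k + 1#))
  drift-trans {n} {e} {k} {S} {S′} {S″} {P} {P′} {P″} S″≤ S′≤ = ≤-by
    (+-nonneg (x≤y⇒0≤y-x S″≤) (x≤y⇒0≤y-x S′≤))
    (solve 9 (λ n e k S S′ S″ P P′ P″ →
        con (+ 50) :* (P″ :- P) :- con (+ 17) :* (n :* e :* (k :+ con (+ 1))) :- con (+ 18) :* n :* (S″ :- S)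
        := (con (+ 50) :* (P″ :- P′) :- con (+ 17) :* (n :* e :* k) :- con (+ 18) :* n :* (S″ :- S′))
        :+ (con (+ 50) :* (P′ :- P) :- con (+ 17) :* (n :* e) :- con (+ 18) :* n :* (S′ :- S))) refl
      n e k S S′ S″ P P′ P″)

  -- On the scale of `n * e`, the value `c` measures at least 80 `l`, while `k + 1#` measures less
  -- than 5 `l` plus `n * e`, hence less than 6 `l`.
  time-bound : ∀ {n e k c l} → 0# < n → 0# < e → e ≤ 1# → 0# < l → n ≤ l →
    fromℕ 80 * l ≤ n * e * c → n * e * k < fromℕ 5 * l → 0# < c - (k + 1#)
  time-bound {n} {e} {k} {c} {l} 0<n 0<e e≤1 0<l n≤l 80l≤ <5l = *-cancelˡ-pos (*-pos 0<n 0<e) (<-respʳ-≈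
    (solve 5 (λ n e k c l →
       (con (+ 5) :* l :- n :* e :* k) :+ ((n :* e :* c :- con (+ 80) :* l)
         :+ ((l :- n) :+ (con (+ 74) :* l :+ n :* (con (+ 1) :- e))))
       := n :* e :* (c :- (k :+ con (+ 1)))) refl n e k c l)
    (+-pos-nonneg (x<y⇒0<y-x <5l)
      (+-nonneg (x≤y⇒0≤y-x 80l≤) (+-nonneg (x≤y⇒0≤y-x n≤l)
        (+-nonneg (*-nonneg (fromℕ-nonneg 74) (<⇒≤ 0<l)) (*-nonneg (<⇒≤ 0<n) (x≤y⇒0≤y-x e≤1)))))))

-- Divergence projections onto the truncated simplex and one mirror step.

module Projections {c ℓ₁ ℓ₂} (R : RealNumbers c ℓ₁ ℓ₂) (N : ℕ) (2≤N : 2 ℕ.≤ N) where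
  open RealNumbers R hiding (zero)
  open RealNumbersProperties R
  open Model R N 2≤N
  open import Relation.Binary.Reasoning.Setoid setoid

  module Variational {ε} (0<ε : 0# < ε) (y : Vector ℝ N) (0<y : ∀ i → 0# < y i)
                     (x : Δ ε) (x-proj : IsProjection 0<ε y 0<y x) where

    -- The gradient of the divergence at `x`, up to the constant 1 in every coordinate. The constant
    -- is harmless because differences of points of the simplex sum to 0.
    logRatio : Vector ℝ N
    logRatio i = ln (coord x i ÷ y i [ 0<y i ]) (÷-pos (Δ-pos 0<ε x i) (0<y i))

    exp-logRatio : ∀ i → exp (logRatio i) * y i ≈ coord x i
    exp-logRatio i = exp-ln-÷ (Δ-pos 0<ε x i) (0<y i)

    segment : (z : Δ ε) (θ : ℝ) → 0# ≤ θ → θ ≤ 1# → Δ ε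
    segment z θ 0≤θ θ≤1 = record
      { coord = λ i → coord x i + θ * (coord z i - coord x i)
      ; sum≈1 = begin
          sum (λ i → coord x i + θ * (coord z i - coord x i))
            ≈⟨ ∑-distrib-+ {N} (coord x) _ ⟩
          sum (coord x) + sum (λ i → θ * (coord z i - coord x i))
            ≈⟨ +-cong (Δ.sum≈1 x) (sym (*-distribˡ-sum {N} θ _)) ⟩
          1# + θ * sum (λ i → coord z i - coord x i)
            ≈⟨ +-congˡ (*-congˡ (trans (∑-distrib-- (coord z) (coord x)) (+-cong (Δ.sum≈1 z) (-‿cong (Δ.sum≈1 x))))) ⟩
          1# + θ * (1# - 1#)
            ≈⟨ solve 1 (λ t → con (+ 1) :+ t :* (con (+ 1) :- con (+ 1)) := con (+ 1)) refl θ ⟩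
          1# ∎
      ; ε/N≤ = λ i → ≤-by
          (+-nonneg (*-nonneg (x≤y⇒0≤y-x θ≤1) (x≤y⇒0≤y-x (Δ.ε/N≤ x i)))
                    (*-nonneg 0≤θ (x≤y⇒0≤y-x (Δ.ε/N≤ z i))))
          (solve 4 (λ a x z t → x :+ t :* (z :- x) :- a
            := (con (+ 1) :- t) :* (x :- a) :+ t :* (z :- a)) refl _ (coord x i) (coord z i) θ)
      }

    -- The divergence along the segment from x to z is bounded by a quadratic
    -- in θ; minimality of x forces its derivative at θ = 0 to be nonnegative.
    variational : ∀ (z : Δ ε) → 0# ≤ sum λ i → (coord z i - coord x i) * logRatio i
    variational z G<0 = <-irrefl refl (<-≤-trans 0<θ[1-G] θ[1-G]≤0)
      where
      d x⁻¹ : Vector ℝ N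
      d i = coord z i - coord x i
      x⁻¹ i = coord x i ⁻¹[ Δ-pos 0<ε x i ]
      G M D θ : ℝ
      G = sum λ i → d i * logRatio i
      M = sum λ i → d i * d i * x⁻¹ i
      0≤x⁻¹ : ∀ i → 0# ≤ x⁻¹ i
      0≤x⁻¹ i = <⇒≤ (⁻¹-pos _ (Δ-pos 0<ε x i))
      0<-G : 0# < 0# - G
      0<-G = x<y⇒0<y-x G<0
      0≤M : 0# ≤ M
      0≤M = sum-nonneg λ i → *-nonneg (square-nonneg (d i)) (0≤x⁻¹ i)
      -- With `θ * D` equal to `0# - G`, the slope bound `G + θ * M` becomes -θ (1 - G), which is
      -- negative; the summand `1# + M` of `D` keeps `θ` at most 1.
      D = 1# + M + (0# - G)
      0<D : 0# < D
      0<D = +-pos-nonneg (+-pos-nonneg 0<1 0≤M) (<⇒≤ 0<-G)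
      θ = (0# - G) ÷ D [ 0<D ]
      θD≈-G : θ * D ≈ 0# - G
      θD≈-G = ÷-* _ D 0<D
      0<θ : 0# < θ
      0<θ = ÷-pos 0<-G 0<D
      θ≤1 : θ ≤ 1#
      θ≤1 = *-cancelˡ-≤ 0<D (≤-by (+-nonneg (<⇒≤ 0<1) 0≤M) (begin
        D * 1# - D * θ         ≈⟨ solve 2 (λ D t → D :* con (+ 1) :- D :* t := D :- t :* D) refl D θ ⟩
        D - θ * D              ≈⟨ +-congˡ (-‿cong θD≈-G) ⟩
        D - (0# - G)           ≈⟨ solve 2 (λ M G → con (+ 1) :+ M :+ G :- G := con (+ 1) :+ M) refl M (0# - G) ⟩
        1# + M                 ∎))
      xθ : Δ ε
      xθ = segment z θ (<⇒≤ 0<θ) θ≤1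
      -- This is ln (1 + r) ≤ r for the relative change r = `θ * d i * x⁻¹ i`, obtained by comparing
      -- exponentials.
      logRatio-segment : ∀ i → ln (coord xθ i ÷ y i [ 0<y i ]) (÷-pos (Δ-pos 0<ε xθ i) (0<y i))
                             ≤ logRatio i + θ * d i * x⁻¹ i
      logRatio-segment i = exp-cancel-≤ (*-cancelˡ-≤ (0<y i) (≤-by
        (*-nonneg (<⇒≤ (Δ-pos 0<ε x i)) (x≤y⇒0≤y-x (1+x≤exp (θ * d i * x⁻¹ i))))
        (begin
          y i * exp (logRatio i + θ * d i * x⁻¹ i) - y i * exp _
            ≈⟨ +-cong (trans (*-congˡ (exp-+ _ _)) (trans (sym (*-assoc _ _ _)) (*-congʳ (trans (*-comm _ _) (exp-logRatio i)))))
                      (-‿cong (trans (*-comm _ _) (exp-ln-÷ (Δ-pos 0<ε xθ i) (0<y i)))) ⟩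
          coord x i * e - (coord x i + θ * d i)
            ≈⟨ +-congˡ (-‿cong (+-congˡ (trans (sym (*-identityʳ _)) (*-congˡ (sym (⁻¹-inverseˡ _ (Δ-pos 0<ε x i))))))) ⟩
          coord x i * e - (coord x i + θ * d i * (x⁻¹ i * coord x i))
            ≈⟨ solve 4 (λ x e t r → x :* e :- (x :+ t :* (r :* x)) := x :* (e :- (con (+ 1) :+ t :* r))) refl
                 (coord x i) e (θ * d i) (x⁻¹ i) ⟩
          coord x i * (e - (1# + θ * d i * x⁻¹ i)) ∎)))
        where e = exp (θ * d i * x⁻¹ i)
      divergence-segment : sum (λ i → coord x i * logRatio i) ≤
                           sum (λ i → coord x i * logRatio i) + θ * (G + θ * M)
      divergence-segment = ≤-trans (x-proj xθ) (≤-trans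
        (sum-mono-≤ λ i → *-monoˡ-≤ (<⇒≤ (Δ-pos 0<ε xθ i)) (logRatio-segment i))
        (≤-reflexive (begin
          sum (λ i → coord xθ i * (logRatio i + θ * d i * x⁻¹ i))
            ≈⟨ sum-cong-≋ expand ⟩
          sum (λ i → coord x i * logRatio i + θ * ((d i * logRatio i + d i) + θ * (d i * d i * x⁻¹ i)))
            ≈⟨ trans (∑-distrib-+ {N} _ _) (+-congˡ (sym (*-distribˡ-sum {N} θ _))) ⟩
          sum (λ i → coord x i * logRatio i) + θ * sum (λ i → (d i * logRatio i + d i) + θ * (d i * d i * x⁻¹ i))
            ≈⟨ +-congˡ (*-congˡ (trans (∑-distrib-+ {N} _ _) (+-cong (∑-distrib-+ {N} _ d) (sym (*-distribˡ-sum {N} θ _))))) ⟩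
          sum (λ i → coord x i * logRatio i) + θ * (G + sum d + θ * M)
            ≈⟨ +-congˡ (*-congˡ (+-congʳ (trans (+-congˡ sum-d) (+-identityʳ G)))) ⟩
          sum (λ i → coord x i * logRatio i) + θ * (G + θ * M) ∎)))
        where
        sum-d : sum d ≈ 0#
        sum-d = trans (∑-distrib-- (coord z) (coord x))
          (trans (+-cong (Δ.sum≈1 z) (-‿cong (Δ.sum≈1 x))) (-‿inverseʳ 1#))
        expand : ∀ i → coord xθ i * (logRatio i + θ * d i * x⁻¹ i) ≈
                       coord x i * logRatio i + θ * ((d i * logRatio i + d i) + θ * (d i * d i * x⁻¹ i))
        expand i = begin
          coord xθ i * (logRatio i + θ * d i * x⁻¹ i)
            ≈⟨ solve 5 (λ x t d v r → (x :+ t :* d) :* (v :+ t :* d :* r)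
                 := x :* v :+ t :* ((d :* v :+ d :* (r :* x)) :+ t :* (d :* d :* r))) refl
                 (coord x i) θ (d i) (logRatio i) (x⁻¹ i) ⟩
          coord x i * logRatio i + θ * ((d i * logRatio i + d i * (x⁻¹ i * coord x i)) + θ * (d i * d i * x⁻¹ i))
            ≈⟨ +-congˡ (*-congˡ (+-congʳ (+-congˡ (trans (*-congˡ (⁻¹-inverseˡ _ (Δ-pos 0<ε x i))) (*-identityʳ _))))) ⟩
          coord x i * logRatio i + θ * ((d i * logRatio i + d i) + θ * (d i * d i * x⁻¹ i)) ∎
      0≤G+θM : 0# ≤ G + θ * M
      0≤G+θM = *-cancelˡ-nonneg 0<θ (≤-respʳ-≈
        (solve 2 (λ a b → a :+ b :- a := b) refl (sum (λ i → coord x i * logRatio i)) _) (x≤y⇒0≤y-x divergence-segment))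
      0<θ[1-G] : 0# < θ * (1# + (0# - G))
      0<θ[1-G] = *-pos 0<θ (+-pos-nonneg 0<1 (<⇒≤ 0<-G))
      θ[1-G]≤0 : θ * (1# + (0# - G)) ≤ 0#
      θ[1-G]≤0 = ≤-by 0≤G+θM (begin
        0# - θ * (1# + (0# - G))
          ≈⟨ solve 3 (λ t G M → con (+ 0) :- t :* (con (+ 1) :+ (con (+ 0) :- G))
               := t :* M :- t :* (con (+ 1) :+ M :+ (con (+ 0) :- G))) refl θ G M ⟩
        θ * M - θ * D          ≈⟨ +-congˡ (-‿cong θD≈-G) ⟩
        θ * M - (0# - G)       ≈⟨ solve 3 (λ t G M → t :* M :- (con (+ 0) :- G) := G :+ t :* M) refl θ G M ⟩
        G + θ * M              ∎)

  logCoord : ∀ {ε} → 0# < ε → Δ ε → Vector ℝ N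
  logCoord 0<ε z i = ln (coord z i) (Δ-pos 0<ε z i)

  -- One update of the algorithm: x = π(h · exp e).
  module MirrorStep {ε} (0<ε : 0# < ε) (h : Δ ε) (e : Vector ℝ N)
                    (0<y : ∀ i → 0# < coord h i * exp (e i))
                    (x : Δ ε) (x-proj : IsProjection 0<ε (λ i → coord h i * exp (e i)) 0<y x)
                    (a : ℝ) (e≤a : ∀ i → e i ≤ a) where

    y : Vector ℝ N
    y i = coord h i * exp (e i)

    open Variational 0<ε y 0<y x x-proj

    scaled≤h : ∀ i → exp (- a) * y i ≤ coord h i
    scaled≤h i = ≤-by
      (*-nonneg (<⇒≤ (Δ-pos 0<ε h i)) (x≤y⇒0≤y-x (≤-respʳ-≈ exp-0 (exp-mono-≤ e-a≤0))))
      (trans (solve 3 (λ h e p → h :- p :* (h :* e) := h :* (con (+ 1) :- e :* p)) refl _ _ _)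
        (*-congˡ (+-congˡ (-‿cong (sym (exp-+ _ _))))))
      where
      e-a≤0 : e i - a ≤ 0#
      e-a≤0 = ≤-by (x≤y⇒0≤y-x (e≤a i)) (solve 2 (λ e a → con (+ 0) :- (e :- a) := a :- e) refl (e i) a)

    -- Moves exactly the growth of coordinate `j` to coordinate `i`. If `i` differs from `j`,
    -- coordinate `j` returns to `coord h j`, which respects the lower bound because `h` lies in the
    -- truncated simplex.
    transfer : (i j : Fin N) → coord h j < coord x j → Δ ε
    transfer i j h<x = record
      { coord = λ k → coord x k + θ * (δ i k * 1# - δ j k * 1#)
      ; sum≈1 = begin
          sum (λ k → coord x k + θ * (δ i k * 1# - δ j k * 1#))
            ≈⟨ trans (∑-distrib-+ {N} (coord x) _) (+-cong (Δ.sum≈1 x) (sym (*-distribˡ-sum {N} θ _))) ⟩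
          1# + θ * sum (λ k → δ i k * 1# - δ j k * 1#)
            ≈⟨ +-congˡ (*-congˡ (trans (∑-distrib-- (λ k → δ i k * 1#) (λ k → δ j k * 1#))
                 (+-cong (sum-δ i (λ _ → 1#)) (-‿cong (sum-δ j (λ _ → 1#)))))) ⟩
          1# + θ * (1# - 1#)
            ≈⟨ solve 1 (λ t → con (+ 1) :+ t :* (con (+ 1) :- con (+ 1)) := con (+ 1)) refl θ ⟩
          1# ∎
      ; ε/N≤ = bound
      }
      where
      θ = coord x j - coord h j
      0≤θ : 0# ≤ θ
      0≤θ = <⇒≤ (x<y⇒0<y-x h<x)
      bound : ∀ k → ε ÷ fromℕ N [ 0<N ] ≤ coord x k + θ * (δ i k * 1# - δ j k * 1#)
      bound k with j ≟ k
      ... | yes ≡.refl = ≤-by (+-nonneg (x≤y⇒0≤y-x (Δ.ε/N≤ h j)) (*-nonneg 0≤θ (0≤δ i j)))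
        (solve 4 (λ x h d b → x :+ (x :- h) :* (d :* con (+ 1) :- con (+ 1) :* con (+ 1)) :- b
            := (h :- b) :+ (x :- h) :* d) refl
          (coord x j) (coord h j) (δ i j) _)
      ... | no _ = ≤-by (+-nonneg (x≤y⇒0≤y-x (Δ.ε/N≤ x k)) (*-nonneg 0≤θ (0≤δ i k)))
        (solve 4 (λ x t d b → x :+ t :* (d :* con (+ 1) :- con (+ 0) :* con (+ 1)) :- b
            := (x :- b) :+ t :* d) refl
          (coord x k) θ (δ i k) _)

    -- A first-order optimality condition: a coordinate that has grown can give up mass, so its
    -- partial derivative must be minimal. The variational inequality at the transferred point is
    -- the difference of the two derivatives times the mass moved.
    logRatio-transfer : ∀ i j → coord h j < coord x j → logRatio j ≤ logRatio i
    logRatio-transfer i j h<x = ≤-by (*-cancelˡ-nonneg (x<y⇒0<y-x h<x)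
      (≤-respʳ-≈ eq (variational (transfer i j h<x)))) refl
      where
      θ = coord x j - coord h j
      eq : sum (λ k → (coord x k + θ * (δ i k * 1# - δ j k * 1#) - coord x k) * logRatio k)
           ≈ θ * (logRatio i - logRatio j)
      eq = begin
        sum (λ k → (coord x k + θ * (δ i k * 1# - δ j k * 1#) - coord x k) * logRatio k)
          ≈⟨ sum-cong-≋ (λ k → solve 5 (λ x t a b v →
               (x :+ t :* (a :* con (+ 1) :- b :* con (+ 1)) :- x) :* v := t :* (a :* v :- b :* v)) refl
               (coord x k) θ (δ i k) (δ j k) (logRatio k)) ⟩
        sum (λ k → θ * (δ i k * logRatio k - δ j k * logRatio k))
          ≈⟨ *-distribˡ-sum {N} θ _ ⟨
        θ * sum (λ k → δ i k * logRatio k - δ j k * logRatio k)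
          ≈⟨ *-congˡ (trans (∑-distrib-- (λ k → δ i k * logRatio k) (λ k → δ j k * logRatio k))
               (+-cong (sum-δ i logRatio) (-‿cong (sum-δ j logRatio)))) ⟩
        θ * (logRatio i - logRatio j) ∎

    -- Otherwise some other coordinate has grown, and moving mass from it to i
    -- would decrease the divergence.
    stability : ∀ i → exp (- a) * y i ≤ coord x i
    stability i x<py = <-irrefl refl (<-≤-trans x<py (≤-trans (scaled≤h i) h≤x))
      where
      x≤h : ∀ j → coord x j ≤ coord h j
      x≤h j h<x = ≤-respʳ-≈ (exp-logRatio i) py≤ x<py
        where
        -- Coordinate `j` grew beyond `coord h j`, which is at least `exp (- a) * y j`; so its
        -- multiplier `exp (logRatio j)` is at least `exp (- a)`.
        -a≤logRatio : - a ≤ logRatio j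
        -a≤logRatio = exp-cancel-≤ (*-cancelˡ-≤ (0<y j) (≤-respˡ-≈ (*-comm _ _)
          (≤-respʳ-≈ (trans (sym (exp-logRatio j)) (*-comm _ _)) (≤-trans (scaled≤h j) (<⇒≤ h<x)))))
        py≤ : exp (- a) * y i ≤ exp (logRatio i) * y i
        py≤ = ≤-respˡ-≈ (*-comm _ _) (≤-respʳ-≈ (*-comm _ _) (*-monoˡ-≤ (<⇒≤ (0<y i))
          (exp-mono-≤ (≤-trans -a≤logRatio (logRatio-transfer i j h<x)))))
      -- Both points sum to 1, so if no coordinate grew, then none shrank.
      h≤x : coord h i ≤ coord x i
      h≤x = ≤-by (x≤y⇒0≤y-x h-x≤0) (solve 2 (λ h x → x :- h := con (+ 0) :- (h :- x)) refl (coord h i) (coord x i))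
        where
        h-x≤0 : coord h i - coord x i ≤ 0#
        h-x≤0 = ≤-respʳ-≈ (trans (∑-distrib-- (coord h) (coord x))
            (trans (+-cong (Δ.sum≈1 h) (-‿cong (Δ.sum≈1 x))) (-‿inverseʳ 1#)))
          (term≤sum {f = λ j → coord h j - coord x j} (λ j → x≤y⇒0≤y-x (x≤h j)) i)

    logRatio-split : ∀ i → logCoord 0<ε x i - logCoord 0<ε h i ≈ e i + logRatio i
    logRatio-split i = begin
      logCoord 0<ε x i - logCoord 0<ε h i
        ≈⟨ +-congʳ (exp-injective (begin
             exp (logCoord 0<ε x i)                           ≈⟨ exp-ln _ _ ⟩
             coord x i                                    ≈⟨ exp-logRatio i ⟨
             exp (logRatio i) * (coord h i * exp (e i))   ≈⟨ *-congˡ (*-congʳ (exp-ln _ _)) ⟨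
             exp (logRatio i) * (exp (logCoord 0<ε h i) * exp (e i)) ≈⟨ *-congˡ (exp-+ _ _) ⟨
             exp (logRatio i) * exp (logCoord 0<ε h i + e i)  ≈⟨ exp-+ _ _ ⟨
             exp (logRatio i + (logCoord 0<ε h i + e i))      ∎)) ⟩
      logRatio i + (logCoord 0<ε h i + e i) - logCoord 0<ε h i
        ≈⟨ solve 3 (λ v h e → v :+ (h :+ e) :- h := e :+ v) refl (logRatio i) (logCoord 0<ε h i) (e i) ⟩
      e i + logRatio i ∎

    -- The regret bound for one step. Each logarithm changes by `e i + logRatio i`. In the average
    -- of `logRatio`, the variational inequality replaces the weights `u` by `x`; the tangent bound
    -- for `exp` at `- a - logRatio i` then bounds `coord x i * logRatio i` below by
    -- `(1# - a) * coord x i - exp (- a) * y i`.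
    regret : (u : Δ ε) →
             sum (λ i → coord u i * e i) + (1# - a - exp (- a) * sum y) ≤
             sum (λ i → coord u i * (logCoord 0<ε x i - logCoord 0<ε h i))
    regret u = ≤-trans
      (≤-by (variational u) (begin
        sum (λ i → coord u i * e i + (coord u i - coord x i) * logRatio i + ((1# - a) * coord x i - exp (- a) * y i))
          - (sum (λ i → coord u i * e i) + (1# - a - exp (- a) * sum y))
          ≈⟨ +-congʳ (trans (∑-distrib-+ {N} _ _) (+-cong (∑-distrib-+ {N} _ _)
               (trans (∑-distrib-- {N} _ _) (+-cong (sym (*-distribˡ-sum {N} (1# - a) _))
                 (-‿cong (sym (*-distribˡ-sum {N} (exp (- a)) _))))))) ⟩
        sum (λ i → coord u i * e i) + V + ((1# - a) * sum (coord x) - exp (- a) * sum y)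
          - (sum (λ i → coord u i * e i) + (1# - a - exp (- a) * sum y))
          ≈⟨ +-congʳ (+-congˡ (+-congʳ (trans (*-congˡ (Δ.sum≈1 x)) (*-identityʳ _)))) ⟩
        sum (λ i → coord u i * e i) + V + (1# - a - exp (- a) * sum y)
          - (sum (λ i → coord u i * e i) + (1# - a - exp (- a) * sum y))
          ≈⟨ solve 3 (λ a v b → a :+ v :+ b :- (a :+ b) := v) refl _ V _ ⟩
        V ∎))
      (sum-mono-≤ termwise)
      where
      V = sum (λ i → (coord u i - coord x i) * logRatio i)
      termwise : ∀ i → coord u i * e i + (coord u i - coord x i) * logRatio i + ((1# - a) * coord x i - exp (- a) * y i) ≤
                       coord u i * (logCoord 0<ε x i - logCoord 0<ε h i)
      termwise i = ≤-by
        (*-nonneg (<⇒≤ (Δ-pos 0<ε x i)) (x≤y⇒0≤y-x (1+x≤exp (- a - logRatio i))))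
        (begin
          coord u i * (logCoord 0<ε x i - logCoord 0<ε h i) - (coord u i * e i + (coord u i - coord x i) * logRatio i + ((1# - a) * coord x i - exp (- a) * y i))
            ≈⟨ +-cong (*-congˡ (logRatio-split i)) (-‿cong (+-congˡ (+-congˡ (-‿cong (*-congʳ (sym (exp-- (- a) (logRatio i)))))))) ⟩
          coord u i * (e i + logRatio i) - (coord u i * e i + (coord u i - coord x i) * logRatio i + ((1# - a) * coord x i - E * exp (logRatio i) * y i))
            ≈⟨ solve 8 (λ u e v x a E r y → u :* (e :+ v) :- (u :* e :+ (u :- x) :* v :+ ((con (+ 1) :- a) :* x :- E :* r :* y))
                 := x :* (v :+ a :- con (+ 1)) :+ E :* (r :* y)) refl
                 (coord u i) (e i) (logRatio i) (coord x i) a E (exp (logRatio i)) (y i) ⟩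
          coord x i * (logRatio i + a - 1#) + E * (exp (logRatio i) * y i)
            ≈⟨ +-congˡ (*-congˡ (exp-logRatio i)) ⟩
          coord x i * (logRatio i + a - 1#) + E * coord x i
            ≈⟨ solve 4 (λ x v a E → x :* (v :+ a :- con (+ 1)) :+ E :* x := x :* (E :- (con (+ 1) :+ (:- a :- v)))) refl
                 (coord x i) (logRatio i) a E ⟩
          coord x i * (E - (1# + (- a - logRatio i))) ∎)
        where E = exp (- a - logRatio i)

-- Queues, work and the backlog gap.

module Queues {c ℓ₁ ℓ₂} (R : RealNumbers c ℓ₁ ℓ₂) (N : ℕ) (2≤N : 2 ℕ.≤ N) where
  open RealNumbers R hiding (zero)
  open RealNumbersProperties R
  open Model R N 2≤N
  open import Relation.Binary.Reasoning.Setoid setoid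

  2≤fromℕ-N : fromℕ 2 ≤ fromℕ N
  2≤fromℕ-N = 2≤fromℕ 2≤N
    where
    2≤fromℕ : ∀ {n} → 2 ℕ.≤ n → fromℕ 2 ≤ fromℕ n
    2≤fromℕ {suc (suc n)} (s≤s (s≤s z≤n)) = ≤-by (fromℕ-nonneg n)
      (solve 1 (λ m → con (+ 1) :+ (con (+ 1) :+ m) :- con (+ 2) := m) refl (fromℕ n))

  -- `sum` splits off its first term, whereas induction on time needs the last one.
  sum-snoc : ∀ t (f : ℕ → ℝ) → sum {suc t} (λ s → f (toℕ s)) ≈ sum {t} (λ s → f (toℕ s)) + f t
  sum-snoc zero    f = +-comm _ _
  sum-snoc (suc t) f = trans (+-congˡ (sum-snoc t (f ∘ suc))) (sym (+-assoc _ _ _))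

  queue-nonneg : ∀ L h s i → 0# ≤ queue L h s i
  queue-nonneg L h zero    i = ≤-refl
  queue-nonneg L h (suc s) i = x≤max _ _

  queue-suc : ∀ L h s i → queue L h (suc s) i ≈ L s i + queue L h s i - workAt L h s i
  queue-suc L h s i = max≈x-min _ _

  workAt-nonneg : ∀ L h s i → 0# ≤ L s i → 0# ≤ h s i → 0# ≤ workAt L h s i
  workAt-nonneg L h s i 0≤L 0≤h = min-greatest 0≤h (+-nonneg 0≤L (queue-nonneg L h s i))

  -- If load and queue together fell short of the allocation, nothing would be left over for the
  -- next step.
  busy⇒h≤workAt : ∀ L h s i → 0# < queue L h (suc s) i → h s i ≤ workAt L h s i
  busy⇒h≤workAt L h s i 0<queue = min-greatest ≤-refl λ q<h → max-least ≤-refl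
    (<⇒≤ (<-by (x<y⇒0<y-x q<h) (solve 2 (λ q h → con (+ 0) :- (q :- h) := h :- q) refl _ (h s i))))
    0<queue

  module _ (L h* h : Profile) where

    queueGap : Profile
    queueGap s i = queue L h s i - queue L h* s i

    backlogGap : ℕ → ℝ
    backlogGap s = sum (queueGap s)

    backlogGap-suc : ∀ s → backlogGap (suc s) ≈ backlogGap s + (sum (workAt L h* s) - sum (workAt L h s))
    backlogGap-suc s = begin
      sum (queueGap (suc s))
        ≈⟨ sum-cong-≋ (λ i → trans (+-cong (queue-suc L h s i) (-‿cong (queue-suc L h* s i)))
             (solve 5 (λ l q q* w w* → (l :+ q :- w) :- (l :+ q* :- w*) := (q :- q*) :+ (w* :- w)) refl
               (L s i) (queue L h s i) (queue L h* s i) (workAt L h s i) (workAt L h* s i))) ⟩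
      sum (λ i → queueGap s i + (workAt L h* s i - workAt L h s i))
        ≈⟨ trans (∑-distrib-+ {N} _ _) (+-congˡ (∑-distrib-- {N} _ _)) ⟩
      backlogGap s + (sum (workAt L h* s) - sum (workAt L h s)) ∎

    -- Both runs receive the same loads, so work not yet done is exactly what is still queued.
    work-gap : ∀ t → work L h* t - work L h t ≈ backlogGap t
    work-gap zero = begin
      0# - 0#                   ≈⟨ -‿inverseʳ 0# ⟩
      0#                        ≈⟨ zeroʳ _ ⟨
      fromℕ N * 0#              ≈⟨ sum-const N 0# ⟨
      sum {N} (λ _ → 0#)        ≈⟨ sum-cong-≋ {N} (λ _ → -‿inverseʳ 0#) ⟨
      sum {N} (λ _ → 0# - 0#)   ∎
    work-gap (suc t) = begin
      work L h* (suc t) - work L h (suc t)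
        ≈⟨ +-cong (sum-snoc t (λ s → sum (workAt L h* s))) (-‿cong (sum-snoc t (λ s → sum (workAt L h s)))) ⟩
      work L h* t + sum (workAt L h* t) - (work L h t + sum (workAt L h t))
        ≈⟨ solve 4 (λ a b x y → a :+ x :- (b :+ y) := (a :- b) :+ (x :- y)) refl _ _ _ _ ⟩
      work L h* t - work L h t + (sum (workAt L h* t) - sum (workAt L h t))
        ≈⟨ +-congʳ (work-gap t) ⟩
      backlogGap t + (sum (workAt L h* t) - sum (workAt L h t))
        ≈⟨ backlogGap-suc t ⟨
      backlogGap (suc t) ∎

    queueGap≤queue : ∀ s i → queueGap s i ≤ queue L h s i
    queueGap≤queue s i = ≤-by (queue-nonneg L h* s i)
      (solve 2 (λ q q* → q :- (q :- q*) := q*) refl _ _)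

    -- A positive gap makes the queue under `h` positive, so its truncation at 0 was not in effect.
    -- Truncation under `h*` can only lower the gap, and apart from it the gap changes by
    -- `h* s i - h s i`, at most 1.
    queueGap-suc : ∀ s i → 0# ≤ h s i → h* s i ≤ 1# → 0# < queueGap (suc s) i →
                   queueGap (suc s) i ≤ queueGap s i + 1#
    queueGap-suc s i 0≤h h*≤1 0<gap = ≤-by
      (+-nonneg (+-nonneg (x≤y⇒0≤y-x (0<max⇒max≤ (<-≤-trans 0<gap (queueGap≤queue (suc s) i))))
                          (x≤y⇒0≤y-x (y≤max 0# (L s i + queue L h* s i - h* s i))))
                (+-nonneg 0≤h (x≤y⇒0≤y-x h*≤1)))
      (solve 7 (λ l q q* h h* Q Q* → (q :- q*) :+ con (+ 1) :- (Q :- Q*)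
          := ((l :+ q :- h) :- Q :+ (Q* :- (l :+ q* :- h*))) :+ (h :+ (con (+ 1) :- h*))) refl
        (L s i) (queue L h s i) (queue L h* s i) (h s i) (h* s i)
        (queue L h (suc s) i) (queue L h* (suc s) i))

-- Near vertices, potentials and the logarithmic range of the truncated simplex.

module Simplex {c ℓ₁ ℓ₂} (R : RealNumbers c ℓ₁ ℓ₂) (N : ℕ) (2≤N : 2 ℕ.≤ N) where
  open RealNumbers R hiding (zero)
  open RealNumbersProperties R
  open Model R N 2≤N
  open Projections R N 2≤N
  open Queues R N 2≤N
  open import Relation.Binary.Reasoning.Setoid setoid

  module _ {ε : ℝ} (0<ε : 0# < ε) where

    coord≤1 : (z : Δ ε) → ∀ i → coord z i ≤ 1#
    coord≤1 z i = ≤-respʳ-≈ (Δ.sum≈1 z) (term≤sum (λ j → <⇒≤ (Δ-pos 0<ε z j)) i)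

    ln[N/ε] : ℝ
    ln[N/ε] = ln (fromℕ N ÷ ε [ 0<ε ]) (÷-pos 0<N 0<ε)

    exp-ln[N/ε] : exp ln[N/ε] * ε ≈ fromℕ N
    exp-ln[N/ε] = exp-ln-÷ 0<N 0<ε

    -- All coordinates lie between ε/N and 1, and the logarithms of these endpoints differ by
    -- `ln[N/ε]`.
    logCoord-range : (z z′ : Δ ε) → ∀ i → logCoord 0<ε z′ i - logCoord 0<ε z i ≤ ln[N/ε]
    logCoord-range z z′ i = ≤-by (x≤y⇒0≤y-x log≤)
      (solve 3 (λ a b l → l :- (a :- b) := b :+ l :- a) refl (logCoord 0<ε z′ i) (logCoord 0<ε z i) ln[N/ε])
      where
      ε/N = ε ÷ fromℕ N [ 0<N ]
      ε/N*exp≈1 : ε/N * exp ln[N/ε] ≈ 1#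
      ε/N*exp≈1 = begin
        ε * fromℕ N ⁻¹[ 0<N ] * exp ln[N/ε]
          ≈⟨ solve 3 (λ e n x → e :* n :* x := n :* (x :* e)) refl ε _ _ ⟩
        fromℕ N ⁻¹[ 0<N ] * (exp ln[N/ε] * ε)   ≈⟨ *-congˡ exp-ln[N/ε] ⟩
        fromℕ N ⁻¹[ 0<N ] * fromℕ N             ≈⟨ ⁻¹-inverseˡ _ 0<N ⟩
        1# ∎
      log≤ : logCoord 0<ε z′ i ≤ logCoord 0<ε z i + ln[N/ε]
      log≤ = exp-cancel-≤ (≤-respˡ-≈ (sym (exp-ln _ _)) (≤-trans (coord≤1 z′ i)
        (≤-by (*-nonneg (<⇒≤ (exp-pos ln[N/ε])) (x≤y⇒0≤y-x (Δ.ε/N≤ z i))) (begin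
          exp (logCoord 0<ε z i + ln[N/ε]) - 1#
            ≈⟨ +-cong (trans (exp-+ _ _) (*-congʳ (exp-ln _ _))) (-‿cong (sym ε/N*exp≈1)) ⟩
          coord z i * exp ln[N/ε] - ε/N * exp ln[N/ε]
            ≈⟨ solve 3 (λ x b e → x :* e :- b :* e := e :* (x :- b)) refl _ _ _ ⟩
          exp ln[N/ε] * (coord z i - ε/N) ∎))))

    module _ (ε≤1 : ε ≤ 1#) where

      -- The vertex `i` mixed with the uniform distribution of weight `ε`, since the vertex itself
      -- is outside the truncated simplex.
      nearVertex : Fin N → Δ ε
      nearVertex i = record
        { coord = λ j → ε ÷ fromℕ N [ 0<N ] + δ i j * (1# - ε)
        ; sum≈1 = begin
            sum (λ j → ε ÷ fromℕ N [ 0<N ] + δ i j * (1# - ε))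
              ≈⟨ trans (∑-distrib-+ {N} _ _) (+-cong (sum-const N _) (sum-δ i (λ _ → 1# - ε))) ⟩
            fromℕ N * (ε ÷ fromℕ N [ 0<N ]) + (1# - ε)
              ≈⟨ +-congʳ (trans (*-comm _ _) (÷-* ε _ 0<N)) ⟩
            ε + (1# - ε)
              ≈⟨ solve 1 (λ e → e :+ (con (+ 1) :- e) := con (+ 1)) refl ε ⟩
            1# ∎
        ; ε/N≤ = λ j → ≤-by (*-nonneg (0≤δ i j) (x≤y⇒0≤y-x ε≤1))
            (solve 2 (λ a b → a :+ b :- a := b) refl _ _)
        }

      nearVertex-diag : ∀ i → 1# - ε ≤ coord (nearVertex i) i
      nearVertex-diag i with i ≟ i
      ... | yes _  = ≤-by (<⇒≤ (÷-pos 0<ε 0<N)) (solve 2 (λ a b → a :+ con (+ 1) :* b :- b := a) refl _ _)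
      ... | no i≢i = contradiction ≡.refl i≢i

      -- Minus the divergence of the near vertex from `z`, up to a term that does not depend on `z`.
      potential : Fin N → Δ ε → ℝ
      potential i z = sum λ j → coord (nearVertex i) j * logCoord 0<ε z j

      potential-diff : ∀ i z z′ → potential i z′ - potential i z ≈
                       sum λ j → coord (nearVertex i) j * (logCoord 0<ε z′ j - logCoord 0<ε z j)
      potential-diff i z z′ = sym (trans
        (sum-cong-≋ (λ j → solve 3 (λ u a b → u :* (a :- b) := u :* a :- u :* b) refl
          (coord (nearVertex i) j) (logCoord 0<ε z′ j) (logCoord 0<ε z j)))
        (∑-distrib-- {N} _ _))

      potential-range : ∀ i z z′ → potential i z′ - potential i z ≤ ln[N/ε]
      potential-range i z z′ = ≤-respˡ-≈ (sym (potential-diff i z z′)) (≤-respʳ-≈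
        (trans (sym (*-distribʳ-sum {N} ln[N/ε] (coord (nearVertex i))))
          (trans (*-congʳ (Δ.sum≈1 (nearVertex i))) (*-identityˡ _)))
        (sum-mono-≤ λ j → *-monoˡ-≤ (<⇒≤ (Δ-pos 0<ε (nearVertex i) j)) (logCoord-range z z′ j)))

    0≤1-sumOver : (A : Subset N) (z : Δ ε) → 0# ≤ 1# - sumOver A (coord z)
    0≤1-sumOver A z = x≤y⇒0≤y-x (≤-respʳ-≈ (Δ.sum≈1 z) (sum-mono-≤ termwise))
      where
      termwise : ∀ i → (if does (i ∈? A) then coord z i else 0#) ≤ coord z i
      termwise i with does (i ∈? A)
      ... | true  = ≤-refl
      ... | false = <⇒≤ (Δ-pos 0<ε z i)

    -- Since N/ε ≥ 2, the exponential of `- ln[N/ε]` is at most 1/2, and the tangent bound makes it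
    -- at least `1# - ln[N/ε]`.
    1≤2ln[N/ε] : ε ≤ 1# → 1# ≤ fromℕ 2 * ln[N/ε]
    1≤2ln[N/ε] ε≤1 = ≤-by
      (+-nonneg (*-nonneg (fromℕ-nonneg 2) (x≤y⇒0≤y-x (1+x≤exp (- ln[N/ε]))))
                (*-nonneg (<⇒≤ (exp-pos (- ln[N/ε]))) (x≤y⇒0≤y-x 2≤exp)))
      (trans (+-congˡ (-‿cong (sym (exp-inverse ln[N/ε]))))
        (trans (solve 3 (λ l E X → con (+ 2) :* l :- E :* X
            := con (+ 2) :* (E :- (E :* X :- l)) :+ E :* (X :- con (+ 2))) refl
            ln[N/ε] (exp (- ln[N/ε])) (exp ln[N/ε]))
          (+-congʳ (*-congˡ (+-congˡ (-‿cong (+-congʳ (exp-inverse ln[N/ε]))))))))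
      where
      2≤exp : fromℕ 2 ≤ exp ln[N/ε]
      2≤exp = *-cancelˡ-≤ 0<ε (≤-respʳ-≈ (trans (sym exp-ln[N/ε]) (*-comm _ _)) (≤-trans
        (≤-by (*-nonneg (fromℕ-nonneg 2) (x≤y⇒0≤y-x ε≤1))
          (solve 1 (λ e → con (+ 2) :- e :* con (+ 2) := con (+ 2) :* (con (+ 1) :- e)) refl ε))
        2≤fromℕ-N))

-- One update of the algorithm: gains, idle capacity and potential.

module Analysis {c ℓ₁ ℓ₂} (R : RealNumbers c ℓ₁ ℓ₂) (N T : ℕ) (2≤N : 2 ℕ.≤ N) where
  open RealNumbers R hiding (zero)
  open RealNumbersProperties R
  open ArithmeticBounds orderedField
  open Model R N 2≤N
  open Projections R N 2≤N
  open Queues R N 2≤N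
  open Simplex R N 2≤N
  open import Relation.Binary.Reasoning.Setoid setoid

  module Run {L : Profile} (0≤L : ∀ s → s ℕ.< T → ∀ i → 0# ≤ L s i) {β : Vector ℝ N}
             {ε} {0<ε : 0# < ε} (10ε≤1 : fromℕ 10 * ε ≤ 1#)
             {η} (0<η : 0# < η) (3η≤1 : fromℕ 3 * η ≤ 1#)
             (alg : Algorithm2 L β T ε 0<ε η) where
    open Algorithm2 alg

    0≤ε : 0# ≤ ε
    0≤ε = <⇒≤ 0<ε

    0≤η : 0# ≤ η
    0≤η = <⇒≤ 0<η

    ε≤1 : ε ≤ 1#
    ε≤1 = ≤-by (+-nonneg (x≤y⇒0≤y-x 10ε≤1) (*-nonneg (fromℕ-nonneg 9) 0≤ε))
      (solve 1 (λ e → con (+ 1) :- e := (con (+ 1) :- con (+ 10) :* e) :+ con (+ 9) :* e) refl ε)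

    Φ : Fin N → ℕ → ℝ
    Φ i s = potential 0<ε ε≤1 i (point s)

    boostε : ℝ
    boostε = boost ε

    0<8N : 0# < fromℕ 8 * fromℕ N
    0<8N = *-pos (fromℕ-pos 8 (s≤s z≤n)) 0<N

    0≤boostε : 0# ≤ boostε
    0≤boostε = <⇒≤ (÷-pos (*-pos 0<ε 0<ε) 0<8N)

    10boostε≤ε : fromℕ 10 * boostε ≤ ε
    10boostε≤ε = *-cancelˡ-≤ 0<8N (≤-by
      (*-nonneg 0≤ε (+-nonneg (x≤y⇒0≤y-x 10ε≤1)
        (+-nonneg (*-nonneg (fromℕ-nonneg 8) (x≤y⇒0≤y-x 2≤fromℕ-N)) (fromℕ-nonneg 15))))
      (begin
        fromℕ 8 * fromℕ N * ε - fromℕ 8 * fromℕ N * (fromℕ 10 * boostε)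
          ≈⟨ solve 3 (λ m e b → con (+ 8) :* m :* e :- con (+ 8) :* m :* (con (+ 10) :* b)
               := con (+ 8) :* m :* e :- con (+ 10) :* (b :* (con (+ 8) :* m))) refl (fromℕ N) ε boostε ⟩
        fromℕ 8 * fromℕ N * ε - fromℕ 10 * (boostε * (fromℕ 8 * fromℕ N))
          ≈⟨ +-congˡ (-‿cong (*-congˡ (÷-* (ε * ε) _ 0<8N))) ⟩
        fromℕ 8 * fromℕ N * ε - fromℕ 10 * (ε * ε)
          ≈⟨ solve 2 (λ m e → con (+ 8) :* m :* e :- con (+ 10) :* (e :* e)
               := e :* ((con (+ 1) :- con (+ 10) :* e) :+ (con (+ 8) :* (m :- con (+ 2)) :+ con (+ 15)))) refl (fromℕ N) ε ⟩
        ε * ((1# - fromℕ 10 * ε) + (fromℕ 8 * (fromℕ N - fromℕ 2) + fromℕ 15)) ∎))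

    -- `a` bounds the exponents of every update, and `p` is the largest shrinkage of a coordinate
    -- that `stability` allows.
    a p : ℝ
    a = η * (1# + boostε)
    p = exp (- a)

    0≤p : 0# ≤ p
    0≤p = <⇒≤ (exp-pos (- a))

    0≤a : 0# ≤ a
    0≤a = *-nonneg 0≤η (+-nonneg (<⇒≤ 0<1) 0≤boostε)

    5a≤2 : fromℕ 5 * a ≤ fromℕ 2
    5a≤2 = *-cancelˡ-≤ (fromℕ-pos 30 (s≤s z≤n)) (≤-by
      (+-nonneg (fromℕ-nonneg 5) (+-nonneg (*-nonneg (fromℕ-nonneg 55) (x≤y⇒0≤y-x 3η≤1))
        (*-nonneg (*-nonneg (fromℕ-nonneg 15) 0≤η) (+-nonneg (x≤y⇒0≤y-x 10boostε≤ε) (x≤y⇒0≤y-x ε≤1)))))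
      (solve 3 (λ n b e → con (+ 30) :* con (+ 2) :- con (+ 30) :* (con (+ 5) :* (n :* (con (+ 1) :+ b)))
        := con (+ 5) :+ (con (+ 55) :* (con (+ 1) :- con (+ 3) :* n)
          :+ con (+ 15) :* n :* ((e :- con (+ 10) :* b) :+ (con (+ 1) :- e)))) refl η boostε ε))

    3≤5p : fromℕ 3 ≤ fromℕ 5 * p
    3≤5p = ≤-by (+-nonneg (*-nonneg (fromℕ-nonneg 5) (x≤y⇒0≤y-x (1+x≤exp (- a)))) (x≤y⇒0≤y-x 5a≤2))
      (solve 2 (λ a p → con (+ 5) :* p :- con (+ 3)
        := con (+ 5) :* (p :- (con (+ 1) :- a)) :+ (con (+ 2) :- con (+ 5) :* a)) refl a p)

    -- Here `1# - p` equals `p * (exp a - 1#)`, which is at least `p * a`; moreover `p` is at least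
    -- 3/5 and `a` at least `η`.
    3η≤5[1-p] : fromℕ 3 * η ≤ fromℕ 5 * (1# - p)
    3η≤5[1-p] = ≤-by
      (+-nonneg (*-nonneg (fromℕ-nonneg 5) (*-nonneg 0≤p (x≤y⇒0≤y-x (1+x≤exp a))))
        (+-nonneg (*-nonneg (x≤y⇒0≤y-x 3≤5p) 0≤a) (*-nonneg (fromℕ-nonneg 3) (*-nonneg 0≤η 0≤boostε))))
      (trans (+-congʳ (*-congˡ (+-congʳ (sym (exp-inverse a)))))
        (solve 4 (λ n b p e → let a = n :* (con (+ 1) :+ b) in
            con (+ 5) :* (p :* e :- p) :- con (+ 3) :* n
            := con (+ 5) :* (p :* (e :- (con (+ 1) :+ a)))
              :+ ((con (+ 5) :* p :- con (+ 3)) :* a :+ con (+ 3) :* (n :* b))) refl η boostε p (exp a)))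

    e : Profile
    e s i = η * gain ε (A s) (A¹ s) i

    0≤gain : ∀ s i → 0# ≤ gain ε (A s) (A¹ s) i
    0≤gain s i with does (i ∈? A¹ s) | does (i ∈? A s)
    ... | true  | _     = +-nonneg (<⇒≤ 0<1) 0≤boostε
    ... | false | true  = <⇒≤ 0<1
    ... | false | false = ≤-refl

    gain≤1+boostε : ∀ s i → gain ε (A s) (A¹ s) i ≤ 1# + boostε
    gain≤1+boostε s i with does (i ∈? A¹ s) | does (i ∈? A s)
    ... | true  | _     = ≤-refl
    ... | false | true  = ≤-by 0≤boostε (solve 1 (λ b → con (+ 1) :+ b :- con (+ 1) := b) refl boostε)
    ... | false | false = +-nonneg (<⇒≤ 0<1) 0≤boostε

    active⇒1≤gain : ∀ s i → i ∈ A s → 1# ≤ gain ε (A s) (A¹ s) i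
    active⇒1≤gain s i i∈A with does (i ∈? A¹ s) | i ∈? A s
    ... | true  | _       = ≤-by 0≤boostε (solve 1 (λ b → con (+ 1) :+ b :- con (+ 1) := b) refl boostε)
    ... | false | yes _   = ≤-refl
    ... | false | no  i∉A = contradiction i∈A i∉A

    inactive⇒gain≈0 : ∀ s → s ℕ.< T → ∀ i → i ∉ A s → gain ε (A s) (A¹ s) i ≈ 0#
    inactive⇒gain≈0 s s<T i i∉A with i ∈? A¹ s | i ∈? A s
    ... | yes i∈A¹ | _       = contradiction (proj₁ (Equivalence.to (underserved s s<T i) i∈A¹)) i∉A
    ... | no  _    | yes i∈A = contradiction i∈A i∉A
    ... | no  _    | no  _   = refl

    module Update (s : ℕ) (s<T : s ℕ.< T) where
      open MirrorStep 0<ε (point s) (e s) (ĥ-pos s) (point (suc s)) (step s s<T)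
                      a (λ i → *-monoˡ-≤ 0≤η (gain≤1+boostε s i)) public

      stable : ∀ i → p * h s i ≤ h (suc s) i
      stable i = ≤-trans (*-monoˡ-≤ 0≤p h≤y) (stability i)
        where
        h≤y : h s i ≤ y i
        h≤y = ≤-by
          (*-nonneg (<⇒≤ (Δ-pos 0<ε (point s) i))
            (+-nonneg (x≤y⇒0≤y-x (1+x≤exp (e s i))) (*-nonneg 0≤η (0≤gain s i))))
          (solve 3 (λ h e x → h :* x :- h := h :* (x :- (con (+ 1) :+ e) :+ e)) refl (h s i) (e s i) (exp (e s i)))

      -- Compensates for the late feedback: the capacity that `h s` leaves outside a set is compared
      -- with what the next allocation leaves outside the same set.
      idle-stable : ∀ B → p * (1# - sumOver B (h s)) ≤ 1# - sumOver B (h (suc s))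
      idle-stable B = ≤-respˡ-≈ (trans (sym (*-distribˡ-sum {N} p _)) (*-congˡ (idle s)))
        (≤-respʳ-≈ (idle (suc s)) (sum-mono-≤ termwise))
        where
        idle : ∀ r → sum (λ i → h r i - (if does (i ∈? B) then h r i else 0#)) ≈ 1# - sumOver B (h r)
        idle r = trans (∑-distrib-- {N} _ _) (+-congʳ (Δ.sum≈1 (point r)))
        termwise : ∀ i → p * (h s i - (if does (i ∈? B) then h s i else 0#)) ≤
                         h (suc s) i - (if does (i ∈? B) then h (suc s) i else 0#)
        termwise i with does (i ∈? B)
        ... | true  = ≤-by ≤-refl (solve 3 (λ p x z → (z :- z) :- p :* (x :- x) := con (+ 0)) refl p (h s i) (h (suc s) i))
        ... | false = ≤-by (x≤y⇒0≤y-x (stable i))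
          (solve 3 (λ p x z → (z :- con (+ 0)) :- p :* (x :- con (+ 0)) := z :- p :* x) refl p (h s i) (h (suc s) i))

      -- An active coordinate grows by a factor of at most 1/`p`, while an inactive one has gain 0
      -- and keeps its value.
      scaled-mass : p * sum y ≤ p + (1# - p) * sumOver (A s) (h s)
      scaled-mass = ≤-respˡ-≈ (sym (*-distribˡ-sum {N} p y)) (≤-respʳ-≈
        (trans (∑-distrib-+ {N} _ _) (+-cong
          (trans (sym (*-distribˡ-sum {N} p (h s))) (trans (*-congˡ (Δ.sum≈1 (point s))) (*-identityʳ p)))
          (sym (*-distribˡ-sum {N} (1# - p) _))))
        (sum-mono-≤ termwise))
        where
        termwise : ∀ i → p * y i ≤ p * h s i + (1# - p) * (if does (i ∈? A s) then h s i else 0#)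
        termwise i = termwise′ (i ∈? A s)
          where
          termwise′ : (d : Dec (i ∈ A s)) → p * y i ≤ p * h s i + (1# - p) * (if does d then h s i else 0#)
          termwise′ (yes _) = ≤-trans (scaled≤h i) (≤-reflexive
            (solve 2 (λ p h → h := p :* h :+ (con (+ 1) :- p) :* h) refl p (h s i)))
          termwise′ (no i∉A) = ≤-reflexive (begin
            p * (h s i * exp (η * gain ε (A s) (A¹ s) i))
              ≈⟨ *-congˡ (*-congˡ (trans (exp-cong (trans (*-congˡ (inactive⇒gain≈0 s s<T i i∉A)) (zeroʳ η))) exp-0)) ⟩
            p * (h s i * 1#)
              ≈⟨ solve 2 (λ p h → p :* (h :* con (+ 1)) := p :* h :+ (con (+ 1) :- p) :* con (+ 0)) refl p (h s i) ⟩
            p * h s i + (1# - p) * 0# ∎)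

      -- Regret against the near vertex of `i`: since `i` is active, that comparator gains at least
      -- `η * (1# - ε)`. The algorithm's own mass is bounded by `scaled-mass`, and subtracting `a`
      -- leaves the error `η * (ε + boostε)`.
      idle≤potential : ∀ i → i ∈ A s →
        (1# - p) * (1# - sumOver (A s) (h s)) ≤ Φ i (suc s) - Φ i s + η * (ε + boostε)
      idle≤potential i i∈A = ≤-by
        (+-nonneg (x≤y⇒0≤y-x regretΦ) (+-nonneg (x≤y⇒0≤y-x scaled-mass) (x≤y⇒0≤y-x η[1-ε]≤)))
        (solve 8 (λ P p m S U n e b → P :+ n :* (e :+ b) :- (con (+ 1) :- p) :* (con (+ 1) :- m)
            := (P :- (U :+ (con (+ 1) :- n :* (con (+ 1) :+ b) :- p :* S)))
              :+ ((p :+ (con (+ 1) :- p) :* m :- p :* S) :+ (U :- n :* (con (+ 1) :- e)))) refl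
          (Φ i (suc s) - Φ i s) p (sumOver (A s) (h s)) (sum y) (sum λ j → coord u j * e s j) η ε boostε)
        where
        u = nearVertex 0<ε ε≤1 i
        regretΦ : sum (λ j → coord u j * e s j) + (1# - a - p * sum y) ≤ Φ i (suc s) - Φ i s
        regretΦ = ≤-respʳ-≈ (sym (potential-diff 0<ε ε≤1 i (point s) (point (suc s)))) (regret u)
        0≤uⱼ : ∀ j → 0# ≤ coord u j
        0≤uⱼ j = <⇒≤ (Δ-pos 0<ε u j)
        η[1-ε]≤ : η * (1# - ε) ≤ sum (λ j → coord u j * e s j)
        η[1-ε]≤ = ≤-trans (≤-by
            (+-nonneg (*-nonneg 0≤η (x≤y⇒0≤y-x (nearVertex-diag 0<ε ε≤1 i)))
              (*-nonneg (*-nonneg (0≤uⱼ i) 0≤η) (x≤y⇒0≤y-x (active⇒1≤gain s i i∈A))))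
            (solve 4 (λ u n e g → u :* (n :* g) :- n :* (con (+ 1) :- e)
              := n :* (u :- (con (+ 1) :- e)) :+ u :* n :* (g :- con (+ 1))) refl
              (coord u i) η ε (gain ε (A s) (A¹ s) i)))
          (term≤sum (λ j → *-nonneg (0≤uⱼ j) (*-nonneg 0≤η (0≤gain s j))) i)

    -- Drift of the backlog gap against a comparator with capacity 1 - 4ε.

    module Comparison (h* : Profile)
                      (h*-alloc : ∀ s → s ℕ.< T → IsAllocation (fromℕ 4 * ε) (h* s)) where

      open IsAllocation

      S : ℕ → ℝ
      S = backlogGap L h* h

      gap : Profile
      gap = queueGap L h* h

      0≤h′ : ∀ s i → 0# ≤ h s i
      0≤h′ s i = <⇒≤ (Δ-pos 0<ε (point s) i)

      optimal-work : ∀ s → s ℕ.< T → sum (workAt L h* s) ≤ 1# - fromℕ 4 * ε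
      optimal-work s s<T = ≤-trans (sum-mono-≤ {N} λ i → min≤x (h* s i) _) (sum≤1-δ (h*-alloc s s<T))

      S-suc≤ : ∀ s → s ℕ.< T → S (suc s) ≤ S s + 1#
      S-suc≤ s s<T = ≤-respˡ-≈ (sym (backlogGap-suc L h* h s)) (≤-by
        (+-nonneg (x≤y⇒0≤y-x (optimal-work s s<T)) (+-nonneg (*-nonneg (fromℕ-nonneg 4) 0≤ε)
          (sum-nonneg {N} λ i → workAt-nonneg L h s i (0≤L s s<T i) (0≤h′ s i))))
        (solve 4 (λ b e w w* → b :+ con (+ 1) :- (b :+ (w* :- w))
            := (con (+ 1) :- con (+ 4) :* e :- w*) :+ (con (+ 4) :* e :+ w)) refl
          (S s) ε (sum (workAt L h s)) (sum (workAt L h* s))))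

      -- Activity at index `suc s` reveals who had a queue left after step `s` and therefore used
      -- the whole allocation `h s i`.
      served≤work : ∀ s → suc s ℕ.< T → sumOver (A (suc s)) (h s) ≤ sum (workAt L h s)
      served≤work s s+1<T = sum-mono-≤ {N} termwise
        where
        termwise : ∀ i → (if does (i ∈? A (suc s)) then h s i else 0#) ≤ workAt L h s i
        termwise i with i ∈? A (suc s)
        ... | yes i∈A = busy⇒h≤workAt L h s i (Equivalence.to (active (suc s) s+1<T i) i∈A)
        ... | no _    = workAt-nonneg L h s i (0≤L s (ℕ.<-trans (ℕ.n<1+n s) s+1<T) i) (0≤h′ s i)

      S-suc≤idle : ∀ s → suc s ℕ.< T → S (suc s) - S s ≤ 1# - sumOver (A (suc s)) (h s) - fromℕ 4 * ε
      S-suc≤idle s s+1<T = ≤-respˡ-≈ (+-congʳ (sym (backlogGap-suc L h* h s))) (≤-by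
        (+-nonneg (x≤y⇒0≤y-x (optimal-work s (ℕ.<-trans (ℕ.n<1+n s) s+1<T))) (x≤y⇒0≤y-x (served≤work s s+1<T)))
        (solve 5 (λ b e w w* m → con (+ 1) :- m :- con (+ 4) :* e :- (b :+ (w* :- w) :- b)
            := (con (+ 1) :- con (+ 4) :* e :- w*) :+ (w :- m)) refl
          (S s) ε (sum (workAt L h s)) (sum (workAt L h* s)) _))

      -- Let W and W′ be the shares that `h s` and `h (suc s)` leave outside `A (suc s)`. Then 18 η
      -- W ≤ 30 η W′ since `p` is at least 3/5, and 30 η W′ ≤ 50 (1 - p) W′, which is at most 50
      -- times the potential increase plus 50 η (ε + `boostε`), where the last term is at most 55 η
      -- ε. The comparator's slack of 18 · 4 η ε = 72 η ε leaves -17 η ε.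
      drift : ∀ s → suc s ℕ.< T → ∀ i → i ∈ A (suc s) →
              fromℕ 18 * η * (S (suc s) - S s) ≤
              fromℕ 50 * (Φ i (suc (suc s)) - Φ i (suc s)) - fromℕ 17 * (η * ε)
      drift s s+1<T i i∈A = drift-bound 0≤η
        (0≤1-sumOver 0<ε (A (suc s)) (point s)) (0≤1-sumOver 0<ε (A (suc s)) (point (suc s)))
        (S-suc≤idle s s+1<T) (U.idle-stable (A (suc s))) 3≤5p 3η≤5[1-p]
        (U′.idle≤potential i i∈A) 10boostε≤ε
        where
        module U = Update s (ℕ.<-trans (ℕ.n<1+n s) s+1<T)
        module U′ = Update (suc s) s+1<T

      ℓ : ℝ
      ℓ = ln[N/ε] 0<ε

      η≤ℓ : η ≤ ℓ
      η≤ℓ = *-cancelˡ-≤ (fromℕ-pos 6 (s≤s z≤n)) (≤-by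
        (+-nonneg (*-nonneg (fromℕ-nonneg 3) (x≤y⇒0≤y-x (1≤2ln[N/ε] 0<ε ε≤1)))
          (+-nonneg (*-nonneg (fromℕ-nonneg 2) (x≤y⇒0≤y-x 3η≤1)) (<⇒≤ 0<1)))
        (solve 2 (λ l n → con (+ 6) :* l :- con (+ 6) :* n
          := con (+ 3) :* (con (+ 2) :* l :- con (+ 1)) :+ (con (+ 2) :* (con (+ 1) :- con (+ 3) :* n) :+ con (+ 1))) refl ℓ η))

      0<ℓ : 0# < ℓ
      0<ℓ = <-≤-trans 0<η η≤ℓ

      -- The backward walk and the induction that bounds the backlog gap.

      module _ (c C : ℝ) (ηε²c≈8ℓ : ε * ε * η * c ≈ fromℕ 8 * ℓ) (N*c≈C : fromℕ N * c ≈ C) where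

        -- One factor `ε` of `ε * ε * η * c` is traded for 1/10.
        80ℓ≤ηεc : fromℕ 80 * ℓ ≤ η * ε * c
        80ℓ≤ηεc = *-cancelˡ-≤ 0<ε (≤-by
          (*-nonneg (*-nonneg (fromℕ-nonneg 8) (<⇒≤ 0<ℓ)) (x≤y⇒0≤y-x 10ε≤1))
          (begin
            ε * (η * ε * c) - ε * (fromℕ 80 * ℓ)
              ≈⟨ solve 4 (λ e n c l → e :* (n :* e :* c) :- e :* (con (+ 80) :* l)
                   := e :* e :* n :* c :- con (+ 80) :* (e :* l)) refl ε η c ℓ ⟩
            ε * ε * η * c - fromℕ 80 * (ε * ℓ)
              ≈⟨ +-congʳ ηε²c≈8ℓ ⟩
            fromℕ 8 * ℓ - fromℕ 80 * (ε * ℓ)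
              ≈⟨ solve 2 (λ e l → con (+ 8) :* l :- con (+ 80) :* (e :* l)
                   := con (+ 8) :* l :* (con (+ 1) :- con (+ 10) :* e)) refl ε ℓ ⟩
            fromℕ 8 * ℓ * (1# - fromℕ 10 * ε) ∎))

        module WalkBack (t : ℕ) (t<T : t ℕ.< T) (S≤C : ∀ s → s ℕ.≤ t → S s ≤ C)
                        (C<S : C < S (suc t)) (i : Fin N) where

          -- The sum of `drift` over the steps from `r` to `t`. The potential is read one index
          -- later than the backlog because the evidence about step `s` enters the update at
          -- `suc s`.
          Potential≤ : ℕ → ℝ → Set ℓ₂
          Potential≤ r k = fromℕ 18 * η * (S t - S r) ≤
            fromℕ 50 * (Φ i (suc t) - Φ i (suc r)) - fromℕ 17 * (η * ε * k)

          -- The potential varies by at most `ℓ`, so a walk this long would have accumulated enough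
          -- slack to bring `S (suc t)` down to `C`.
          ¬far : ∀ r k → r ℕ.≤ t → Potential≤ r k → ¬ fromℕ 4 * ℓ < η * ε * k
          ¬far r k r≤t potential≤ 4ℓ<κ = *-cancelˡ-≤ (*-pos (fromℕ-pos 18 (s≤s z≤n)) 0<η)
            (stopping-bound 0≤η η≤ℓ (S-suc≤ t t<T) (S≤C r r≤t)
              (potential-range 0<ε ε≤1 i (point (suc r)) (point (suc t))) potential≤ (<⇒≤ 4ℓ<κ)) C<S

          -- While the walk is short, `k + 1#` stays below `c`, so the gap of user `i` is still
          -- positive, and one more step back costs at most 1.
          gap-pred : ∀ r k → r ℕ.≤ t → η * ε * k < fromℕ 5 * ℓ → c < gap (suc r) i + k →
                     0# < gap r i × c < gap r i + (k + 1#)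
          gap-pred r k r≤t κ<5ℓ c<gap+k = 0<gap , c<gap+[k+1]
            where
            0<c-k-1 : 0# < c - (k + 1#)
            0<c-k-1 = time-bound 0<η 0<ε ε≤1 0<ℓ η≤ℓ 80ℓ≤ηεc κ<5ℓ
            0<gap-suc : 0# < gap (suc r) i
            0<gap-suc = <-respʳ-≈
              (solve 3 (λ c k G → (c :- (k :+ con (+ 1))) :+ ((G :+ k :- c) :+ con (+ 1)) := G) refl c k (gap (suc r) i))
              (+-pos-nonneg 0<c-k-1 (+-nonneg (<⇒≤ (x<y⇒0<y-x c<gap+k)) (<⇒≤ 0<1)))
            gap≤ : gap (suc r) i ≤ gap r i + 1#
            gap≤ = queueGap-suc L h* h r i (0≤h′ r i) (h≤1 (h*-alloc r (ℕ.≤-<-trans r≤t t<T)) i) 0<gap-suc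
            c<gap+[k+1] : c < gap r i + (k + 1#)
            c<gap+[k+1] = <-≤-trans c<gap+k (≤-by (x≤y⇒0≤y-x gap≤)
              (solve 3 (λ g k G → g :+ (k :+ con (+ 1)) :- (G :+ k) := g :+ con (+ 1) :- G) refl
                (gap r i) k (gap (suc r) i)))
            0<gap : 0# < gap r i
            0<gap = <-respʳ-≈
              (solve 3 (λ c k g → (c :- (k :+ con (+ 1))) :+ (g :+ (k :+ con (+ 1)) :- c) := g) refl c k (gap r i))
              (+-pos-nonneg 0<c-k-1 (<⇒≤ (x<y⇒0<y-x c<gap+[k+1])))

          -- A positive gap means a nonempty queue of the algorithm, so user `i` is active and
          -- `drift` applies.
          potential≤-pred : ∀ r k → suc r ℕ.≤ t → 0# < gap (suc r) i →
                            Potential≤ (suc r) k → Potential≤ r (k + 1#)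
          potential≤-pred r k r<t 0<gap potential≤ = drift-trans potential≤ (drift r r+1<T i i∈A)
            where
            r+1<T : suc r ℕ.< T
            r+1<T = ℕ.≤-<-trans r<t t<T
            i∈A : i ∈ A (suc r)
            i∈A = Equivalence.from (active (suc r) r+1<T i)
              (<-≤-trans 0<gap (queueGap≤queue L h* h (suc r) i))

          -- The order is not decidable; cotransitivity needs overlapping alternatives to choose
          -- between stopping the walk and continuing it.
          4ℓ<5ℓ : fromℕ 4 * ℓ < fromℕ 5 * ℓ
          4ℓ<5ℓ = <-by 0<ℓ (solve 1 (λ l → con (+ 5) :* l :- con (+ 4) :* l := l) refl ℓ)

          -- k = t - r counts the steps walked back.
          walkBack : ∀ r k → r ℕ.≤ t → c < gap (suc r) i + k → ¬ Potential≤ r k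
          walkBack zero k r≤t c<gap+k potential≤ = [ ¬far zero k r≤t potential≤ ,
            -- At index 0 both queues are empty, so the gap cannot be positive.
            (λ κ<5ℓ → <-irrefl (sym (-‿inverseʳ 0#)) (proj₁ (gap-pred zero k r≤t κ<5ℓ c<gap+k))) ]′
            (<-cotrans 4ℓ<5ℓ (η * ε * k))
          walkBack (suc r) k r<t c<gap+k potential≤ = [ ¬far (suc r) k r<t potential≤ , (λ κ<5ℓ →
            let 0<gap , c<gap+[k+1] = gap-pred (suc r) k r<t κ<5ℓ c<gap+k in
            walkBack r (k + 1#) (ℕ.<⇒≤ r<t) c<gap+[k+1] (potential≤-pred r k r<t 0<gap potential≤)) ]′
            (<-cotrans 4ℓ<5ℓ (η * ε * k))

          gap≤c : gap (suc t) i ≤ c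
          gap≤c c<gap = walkBack t 0# ℕ.≤-refl (<-respʳ-≈ (sym (+-identityʳ _)) c<gap)
            (≤-reflexive (solve 4 (λ n S P e → con (+ 18) :* n :* (S :- S) :=
               con (+ 50) :* (P :- P) :- con (+ 17) :* (n :* e :* con (+ 0))) refl η (S t) (Φ i (suc t)) ε))

        backlogGap≤ : ∀ t → t ℕ.≤ T → S t ≤ C
        backlogGap≤ t t≤T = upTo t t≤T t ℕ.≤-refl
          where
          0≤c : 0# ≤ c
          0≤c = *-cancelˡ-nonneg (*-pos (*-pos 0<ε 0<ε) 0<η)
            (≤-respʳ-≈ (sym ηε²c≈8ℓ) (*-nonneg (fromℕ-nonneg 8) (<⇒≤ 0<ℓ)))
          gaps≤c⇒S≤C : ∀ s → (∀ i → gap s i ≤ c) → S s ≤ C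
          gaps≤c⇒S≤C s gap≤c = ≤-respʳ-≈ (trans (sum-const N c) N*c≈C) (sum-mono-≤ {N} gap≤c)
          -- The bound is carried for all earlier indices at once, since the walk may stop at any of
          -- them.
          upTo : ∀ t → t ℕ.≤ T → ∀ s → s ℕ.≤ t → S s ≤ C
          upTo t       t≤T zero    _ = gaps≤c⇒S≤C zero λ i → ≤-respˡ-≈ (sym (-‿inverseʳ 0#)) 0≤c
          -- The goal is a negation, so `C < S (suc s)` may be assumed; it bounds every single gap
          -- by `c`, and summing over the users refutes it.
          upTo (suc t) t<T (suc s) (s≤s s≤t) C<S =
            gaps≤c⇒S≤C (suc s) (WalkBack.gap≤c s (ℕ.≤-<-trans s≤t t<T)
              (λ r r≤s → upTo t (ℕ.<⇒≤ t<T) r (ℕ.≤-trans r≤s s≤t)) C<S) C<S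

      work-gap≤ : ∀ t → t ℕ.≤ T → work L h* t - work L h t ≤
                  fromℕ 8 * (fromℕ N ÷ (ε * ε * η) [ *-pos (*-pos 0<ε 0<ε) 0<η ]) * ℓ
      work-gap≤ t t≤T = ≤-respˡ-≈ (sym (work-gap L h* h t)) (backlogGap≤ (fromℕ 8 * q * ℓ) _
        (begin
          ε * ε * η * (fromℕ 8 * q * ℓ)
            ≈⟨ solve 3 (λ d q l → d :* (con (+ 8) :* q :* l) := con (+ 8) :* l :* (q :* d)) refl (ε * ε * η) q ℓ ⟩
          fromℕ 8 * ℓ * (q * (ε * ε * η))    ≈⟨ *-congˡ (⁻¹-inverseˡ _ 0<ε²η) ⟩
          fromℕ 8 * ℓ * 1#                   ≈⟨ *-identityʳ _ ⟩
          fromℕ 8 * ℓ                        ∎)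
        (solve 3 (λ m q l → m :* (con (+ 8) :* q :* l) := con (+ 8) :* (m :* q) :* l) refl (fromℕ N) q ℓ)
        t t≤T)
        where
        0<ε²η : 0# < ε * ε * η
        0<ε²η = *-pos (*-pos 0<ε 0<ε) 0<η
        q : ℝ
        q = (ε * ε * η) ⁻¹[ 0<ε²η ]

theorem5 : ∀ {c ℓ₁ ℓ₂} (R : RealNumbers c ℓ₁ ℓ₂) (N T : ℕ) (2≤N : 2 ℕ.≤ N) → 1 ℕ.≤ T →
  let open RealNumbers R
      open Model R N 2≤N
  in
  (L : Profile) → (∀ s → s ℕ.< T → ∀ i → 0# ≤ L s i) →
  (β : Vector ℝ N) → (∀ i → 0# ≤ β i) →
  (ε : ℝ) (0<ε : 0# < ε) → ε ≤ 1# ÷ fromℕ 10 [ fromℕ-pos 10 (s≤s z≤n) ] →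
  (η : ℝ) (0<η : 0# < η) → η < 1# ÷ fromℕ 3 [ fromℕ-pos 3 (s≤s z≤n) ] →
  (alg : Algorithm2 L β T ε 0<ε η) →
  (h* : Profile) → IsOptimal (fromℕ 4 * ε) L T h* →
  ∀ t → 1 ℕ.≤ t → t ℕ.≤ T →
  work L h* t - work L (Algorithm2.h alg) t ≤
    fromℕ 8 * (fromℕ N ÷ (ε * ε * η) [ *-pos (*-pos 0<ε 0<ε) 0<η ])
            * ln (fromℕ N ÷ ε [ 0<ε ]) (÷-pos 0<N 0<ε)
theorem5 R N T 2≤N _ L 0≤L β _ ε 0<ε ε≤1/10 η 0<η η<1/3 alg h* opt t _ t≤T =
  Run.Comparison.work-gap≤ 0≤L (≤÷⇒*≤ _ ε≤1/10) 0<η (≤÷⇒*≤ _ (<⇒≤ η<1/3)) alg h*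
    (IsOptimal.isAllocation opt) t t≤T
  where
  open RealNumbersProperties R
  open Analysis R N T 2≤N
  open Model R N 2≤N
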